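{- An affine permutation $w\in\widetilde S_n$ is $1$-stack-sortable if and only if it is $231$-avoiding. The number of $1$-stack-sortable elements of $\widetilde S_n$ is $\binom{2n-1}{n}$.
   Context: An affine permutation of size $n$ is a bijection $w:\mathbb Z\to\mathbb Z$ with $w(i+n)=w(i)+n$ for all $i\in\mathbb Z$ and $\sum_{i=1}^n w(i)=\binom{n+1}{2}$. They form the affine symmetric group $\widetilde S_n$ under composition, a Coxeter group of type $\widetilde A_{n-1}$ with simple generators $\widetilde s_1,\ldots,\widetilde s_n$, where $\widetilde s_i$ swaps $i+mn$ and $i+mn+1$ for all $m\in\mathbb Z$ and fixes all other integers. The left weak order is $x\leq_L y\iff\ell(yx^{ -1})=\ell(y)-\ell(x)$, $\ell$ being Coxeter length; $e$ is the identity. Affine sylvester congruence. For $w\in\widetilde S_n$ define a partial order $\preceq_w$ on $\mathbb Z$ (positions): for $i<j$, the positions $i,j$ are incomparable if and only if there is $k$ with $i<k<j$ and $w(k)>\max\{w(i),w(j)\}$; otherwise the position with the smaller value of $w$ is below the other. (This is the descendant order of the decreasing affine binary plane tree with in-order reading $w$.) The affine sylvester congruence is $v\equiv_{\widetilde{\mathrm{syl}}}w\iff{\preceq_v}={\preceq_w}$; it is a semilattice congruence on $(\widetilde S_n,\leq_L)$ in which $\{e\}$ is a class, and each class has a unique $\leq_L$-minimal element. Let $\pi_\downarrow(w)$ be the minimal element of the class of $w$. The affine stack-sorting map is $\widetilde{\mathtt s}:\widetilde S_n\to\widetilde S_n$, $\widetilde{\mathtt s}(w)=w\,(\pi_\downarrow(w))^{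 -1}$. An affine permutation $w\in\widetilde S_n$ is $1$-stack-sortable if $\widetilde{\mathtt s}(w)=e$. It is $231$-avoiding if there are no $i<j<k$ in $\mathbb Z$ with $w(k)<w(i)<w(j)$. The enumeration of $231$-avoiding affine permutations in $\widetilde S_n$ as $\binom{2n-1}{n}$ is due to Crites. -}

module Defs where

open import Algebra.Bundles using (Group)
open import Data.Fin.Base using (Fin; toℕ; fromℕ; fromℕ<; inject₁)
open import Data.Fin.Permutation using (Permutation′; permutation)
open import Data.Fin.Properties using (toℕ-fromℕ; toℕ-fromℕ<; toℕ-inject₁; toℕ-injective; toℕ<n)
open import Data.Integer.Base hiding (suc; pos)
open import Data.Integer.DivMod using (_%ℕ_; _/ℕ_; n%ℕd<d; a≡a%ℕn+[a/ℕn]*n)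
open import Data.Integer.Properties
open import Data.Integer.Tactic.RingSolver using (solve-∀)
open import Data.List.Base using (List; foldr; length)
open import Data.List.Relation.Unary.All using (All)
import Data.Nat.Base as ℕ
open ℕ using (ℕ; zero; suc)
open import Data.Nat.Combinatorics using (_C_; nC1≡n; nCk+nC[k+1]≡[n+1]C[k+1])
import Data.Nat.Divisibility as ℕ
import Data.Nat.Properties as ℕ
open import Data.Product.Base using (Σ; ∃-syntax; _×_; _,_; proj₁; proj₂)
open import Function.Base using (_∘_; _on_)
open import Function.Bundles using (_↔_; _⇔_; Inverse)
open import Function.Construct.Composition using (_↔-∘_)
open import Function.Construct.Identity using (↔-id)
open import Function.Construct.Symmetry using (↔-sym)
open import Level using (0ℓ)
open import Relation.Binary.Bundles using (Setoid)
import Relation.Binary.Construct.On as On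
open import Relation.Binary.PropositionalEquality
open import Relation.Nullary using (¬_)

open import Algebra.Properties.CommutativeMonoid.Sum +-0-commutativeMonoid
  using (sum-syntax; sum-cong-≗; sum-init-last; ∑-distrib-+; sum-permute)
open import Algebra.Properties.AbelianGroup +-0-abelianGroup
  using () renaming (∙-cancelʳ to +-cancelʳ)

open Inverse using (to; from; strictlyInverseˡ; strictlyInverseʳ)

-- The k-th element of the window 1, …, n, where k is counted from 0.
window : ∀ {n} → Fin n → ℤ
window k = + suc (toℕ k)

record AffinePermutation (n : ℕ) : Set where
  field
    bijection  : ℤ ↔ ℤ
    periodic   : ∀ i → to bijection (i + + n) ≡ to bijection i + + n
    normalised : ∑[ k < n ] to bijection (window k) ≡ + (suc n C 2)

open AffinePermutation

infixl 20 _⟨_⟩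

_⟨_⟩ : ∀ {n} → AffinePermutation n → ℤ → ℤ
w ⟨ i ⟩ = to (bijection w) i

infix 4 _≈_

_≈_ : ∀ {n} → AffinePermutation n → AffinePermutation n → Set
v ≈ w = ∀ i → v ⟨ i ⟩ ≡ w ⟨ i ⟩

module Reindexing where

  ∑-window : ∀ n → ∑[ k < n ] window k ≡ + (suc n C 2)
  ∑-window zero    = refl
  ∑-window (suc n) = begin
    ∑[ k < suc n ] window k  ≡⟨ sum-init-last {n} window ⟩
    ∑[ k < n ] window (inject₁ k) + window (fromℕ n)
      ≡⟨ cong₂ _+_ (sum-cong-≗ {n} (λ k → cong (+_ ∘ suc) (toℕ-inject₁ k)))
                   (cong (+_ ∘ suc) (toℕ-fromℕ n)) ⟩
    ∑[ k < n ] window k + + suc n  ≡⟨ cong (_+ + suc n) (∑-window n) ⟩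
    + (suc n C 2 ℕ.+ suc n)  ≡⟨ cong +_ (ℕ.+-comm (suc n C 2) (suc n)) ⟩
    + (suc n ℕ.+ suc n C 2)
      ≡⟨ cong (λ m → + (m ℕ.+ suc n C 2)) (sym (nC1≡n (suc n))) ⟩
    + (suc n C 1 ℕ.+ suc n C 2)
      ≡⟨ cong +_ (nCk+nC[k+1]≡[n+1]C[k+1] (suc n) 1) ⟩
    + (suc (suc n) C 2)  ∎
    where open ≡-Reasoning

  Periodic : ℕ → (ℤ → ℤ) → Set
  Periodic n f = ∀ i → f (i + + n) ≡ f i + + n

  Invariant : ℕ → (ℤ → ℤ) → Set
  Invariant n f = ∀ i → f (i + + n) ≡ f i

  -- c = 1 gives periodicity, c = 0 invariance.
  shift : ∀ (N c : ℤ) (f : ℤ → ℤ) → (∀ i → f (i + N) ≡ f i + c * N) →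
          ∀ i q → f (i + q * N) ≡ f i + q * (c * N)
  shift N c f step i q = go q
    where
    open ≡-Reasoning

    up : ∀ i k → f (i + + k * N) ≡ f i + + k * (c * N)
    up i zero    = begin
      f (i + + 0 * N)      ≡⟨ cong f (trans (cong (λ x → i + x) (*-zeroˡ N)) (+-identityʳ i)) ⟩
      f i                  ≡⟨ sym (trans (cong (λ x → f i + x) (*-zeroˡ (c * N))) (+-identityʳ (f i))) ⟩
      f i + + 0 * (c * N)  ∎
    up i (suc k) = begin
      f (i + + suc k * N)          ≡⟨ cong f (split i (+ k) N) ⟩
      f (i + + k * N + N)          ≡⟨ step _ ⟩
      f (i + + k * N) + c * N      ≡⟨ cong (_+ c * N) (up i k) ⟩
      f i + + k * (c * N) + c * N  ≡⟨ sym (split (f i) (+ k) (c * N)) ⟩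
      f i + + suc k * (c * N)      ∎
      where
      split : ∀ x k y → x + (+ 1 + k) * y ≡ x + k * y + y
      split = solve-∀

    go : ∀ q → f (i + q * N) ≡ f i + q * (c * N)
    go (+ k)      = up i k
    go -[1+ k ]   = begin
      f j                            ≡⟨ add-sub (f j) (+ suc k) (c * N) ⟩
      f j + + suc k * (c * N) + - + suc k * (c * N)
        ≡⟨ cong (_+ - + suc k * (c * N)) (sym (up j (suc k))) ⟩
      f (j + + suc k * N) + - + suc k * (c * N)
        ≡⟨ cong (λ x → f x + - + suc k * (c * N)) (sub-add i (+ suc k) N) ⟩
      f i + - + suc k * (c * N)      ∎
      where
      j = i + -[1+ k ] * N
      add-sub : ∀ x k y → x ≡ x + k * y + - k * y
      add-sub = solve-∀
      sub-add : ∀ x k y → x + - k * y + k * y ≡ x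
      sub-add = solve-∀

  shift-periodic : ∀ {n f} → Periodic n f → ∀ i q → f (i + q * + n) ≡ f i + q * + n
  shift-periodic {n} {f} per i q = trans
    (shift (+ n) (+ 1) f (λ j → trans (per j) (cong (λ x → f j + x) (sym (*-identityˡ (+ n))))) i q)
    (cong (λ x → f i + q * x) (*-identityˡ (+ n)))

  shift-invariant : ∀ {n f} → Invariant n f → ∀ i q → f (i + q * + n) ≡ f i
  shift-invariant {n} {f} inv i q = trans
    (shift (+ n) (+ 0) f
      (λ j → trans (inv j) (sym (trans (cong (λ x → f j + x) (*-zeroˡ (+ n))) (+-identityʳ (f j))))) i q)
    (zeros (f i) q (+ n))
    where
    zeros : ∀ x q y → x + q * (+ 0 * y) ≡ x
    zeros = solve-∀

  from-periodic : ∀ {n} (p : ℤ ↔ ℤ) → Periodic n (to p) → Periodic n (from p)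
  from-periodic {n} p per i = begin
    from p (i + + n)                ≡⟨ cong (λ x → from p (x + + n)) (sym (strictlyInverseˡ p i)) ⟩
    from p (to p (from p i) + + n)  ≡⟨ cong (from p) (sym (per (from p i))) ⟩
    from p (to p (from p i + + n))  ≡⟨ strictlyInverseʳ p _ ⟩
    from p i + + n                  ∎
    where open ≡-Reasoning

  module Residues (m : ℕ) where

    n : ℕ
    n = suc m

    open ≡-Reasoning

    residue : ∀ j → Σ (Fin n) λ k → ∃[ q ] j ≡ window k + q * + n
    residue j = fromℕ< r<n , q , (begin
      j                              ≡⟨ un-shift j ⟩
      (j - + 1) + + 1                ≡⟨ cong (_+ + 1) (a≡a%ℕn+[a/ℕn]*n (j - + 1) n) ⟩
      (+ r + q * + n) + + 1          ≡⟨ re-shift (+ r) (q * + n) ⟩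
      + suc r + q * + n              ≡⟨ cong (λ x → + suc x + q * + n) (sym (toℕ-fromℕ< r<n)) ⟩
      window (fromℕ< r<n) + q * + n     ∎)
      where
      r = (j - + 1) %ℕ n
      q = (j - + 1) /ℕ n
      r<n = n%ℕd<d (j - + 1) n
      un-shift : ∀ j → j ≡ (j - + 1) + + 1
      un-shift = solve-∀
      re-shift : ∀ r x → (r + x) + + 1 ≡ (+ 1 + r) + x
      re-shift = solve-∀

    res : ℤ → Fin n
    res j = proj₁ (residue j)

    window-unique : ∀ (a b : Fin n) q → window a ≡ window b + q * + n → a ≡ b
    window-unique a b q eq = toℕ-injective (+-injective (i-j≡0⇒i≡j (+ toℕ a) (+ toℕ b) a-b≡0))
      where
      A = + toℕ a
      B = + toℕ b
      cancel : ∀ a b x → (+ 1 + a) ≡ (+ 1 + b) + x → a - b ≡ x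
      cancel a b x e = trans (l a b) (trans (cong (_- (+ 1 + b)) e) (r b x))
        where
        l : ∀ a b → a - b ≡ (+ 1 + a) - (+ 1 + b)
        l = solve-∀
        r : ∀ b x → (+ 1 + b) + x - (+ 1 + b) ≡ x
        r = solve-∀
      n∣ : n ℕ.∣ ∣ A - B ∣
      n∣ = ℕ.divides ∣ q ∣ (trans (cong ∣_∣ (cancel A B (q * + n) eq)) (abs-* q (+ n)))
      small : ∣ A - B ∣ ℕ.< n
      small = ℕ.≤-<-trans
        (ℕ.≤-trans (ℕ.≤-reflexive (cong ∣_∣ (m-n≡m⊖n (toℕ a) (toℕ b))))
                   (∣m⊝n∣≤m⊔n (toℕ a) (toℕ b)))
        (ℕ.⊔-lub (toℕ<n a) (toℕ<n b))
      zero-of : ∀ d → n ℕ.∣ d → d ℕ.< n → d ≡ 0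
      zero-of zero    _  _  = refl
      zero-of (suc d) n∣d d<n with () ← ℕ.<⇒≱ d<n (ℕ.∣⇒≤ n∣d)
      a-b≡0 : A - B ≡ + 0
      a-b≡0 = ∣i∣≡0⇒i≡0 (zero-of _ n∣ small)

    -- If p and p′ are mutually inverse and n-periodic, so are the maps they induce on residues.
    induced-inverse : ∀ (p p′ : ℤ → ℤ) → Periodic n p → (∀ i → p (p′ i) ≡ i) →
                      ∀ k → res (p (window (res (p′ (window k))))) ≡ k
    induced-inverse p p′ per inv k = sym (window-unique k b (q + q′) (begin
      window k                          ≡⟨ sym (inv (window k)) ⟩
      p (p′ (window k))                 ≡⟨ cong p eq ⟩
      p (window a + q * + n)            ≡⟨ shift-periodic {n} {p} per (window a) q ⟩
      p (window a) + q * + n            ≡⟨ cong (_+ q * + n) eq′ ⟩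
      window b + q′ * + n + q * + n     ≡⟨ collect (window b) q q′ (+ n) ⟩
      window b + (q + q′) * + n         ∎))
      where
      a   = res (p′ (window k))
      q   = proj₁ (proj₂ (residue (p′ (window k))))
      eq  = proj₂ (proj₂ (residue (p′ (window k))))
      b   = res (p (window a))
      q′  = proj₁ (proj₂ (residue (p (window a))))
      eq′ = proj₂ (proj₂ (residue (p (window a))))
      collect : ∀ x q q′ y → x + q′ * y + q * y ≡ x + (q + q′) * y
      collect = solve-∀

    induced : (p : ℤ ↔ ℤ) → Periodic n (to p) → Permutation′ n
    induced p per = permutation (res ∘ to p ∘ window) (res ∘ from p ∘ window)
      (induced-inverse (to p) (from p) per (strictlyInverseˡ p))
      (induced-inverse (from p) (to p) (from-periodic p per) (strictlyInverseʳ p))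

    sum-reindex : ∀ (p : ℤ ↔ ℤ) → Periodic n (to p) → ∀ f → Invariant n f →
                  ∑[ k < n ] f (to p (window k)) ≡ ∑[ k < n ] f (window k)
    sum-reindex p per f inv = sym (trans
      (sum-permute (f ∘ window) (induced p per))
      (sum-cong-≗ {n} (λ k → sym (trans
        (cong f (proj₂ (proj₂ (residue (to p (window k))))))
        (shift-invariant {n} {f} inv (window (res (to p (window k))))
          (proj₁ (proj₂ (residue (to p (window k))))))))))

  displacement : (ℤ → ℤ) → ℤ → ℤ
  displacement f i = f i - i

  displacement-invariant : ∀ {n f} → Periodic n f → Invariant n (displacement f)
  displacement-invariant {n} {f} per i =
    trans (cong (_- (i + + n)) (per i)) (cancel (f i) i (+ n))
    where
    cancel : ∀ x i y → (x + y) - (i + y) ≡ x - i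
    cancel = solve-∀

  -- ∑ (f(p(k)) - p(k)) = ∑ (f(k) - k) for p an n-periodic bijection and f n-periodic.
  sum-∘ : ∀ n (p : ℤ ↔ ℤ) → Periodic n (to p) → ∀ f → Periodic n f →
          ∑[ k < n ] f (to p (window k)) + ∑[ k < n ] window k ≡
          ∑[ k < n ] f (window k) + ∑[ k < n ] to p (window k)
  sum-∘ zero    _ _   _ _    = refl
  sum-∘ (suc m) p per f perf = begin
    ∑[ k < n ] f (to p (window k)) + S
      ≡⟨ cong (_+ S) (sum-cong-≗ {n} (λ k → restore (f (to p (window k))) (to p (window k)))) ⟩
    ∑[ k < n ] (d (to p (window k)) + to p (window k)) + S
      ≡⟨ cong (_+ S) (∑-distrib-+ {n} (d ∘ to p ∘ window) (to p ∘ window)) ⟩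
    ∑[ k < n ] d (to p (window k)) + T + S
      ≡⟨ cong (λ x → x + T + S) (sum-reindex p per d (displacement-invariant {n} {f} perf)) ⟩
    ∑[ k < n ] d (window k) + T + S
      ≡⟨ swap (∑[ k < n ] d (window k)) T S ⟩
    ∑[ k < n ] d (window k) + S + T
      ≡⟨ cong (_+ T) (sym (∑-distrib-+ {n} (d ∘ window) window)) ⟩
    ∑[ k < n ] (d (window k) + window k) + T
      ≡⟨ cong (_+ T) (sum-cong-≗ {n} (λ k → sym (restore (f (window k)) (window k)))) ⟩
    ∑[ k < n ] f (window k) + T
      ∎
    where
    open Residues m
    open ≡-Reasoning
    d = displacement f
    S = ∑[ k < n ] window k
    T = ∑[ k < n ] to p (window k)
    restore : ∀ x y → x ≡ (x - y) + y
    restore = solve-∀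
    swap : ∀ x y z → x + y + z ≡ x + z + y
    swap = solve-∀

open Reindexing

infixl 7 _∙_
infix 21 _⁻¹

ε : ∀ {n} → AffinePermutation n
ε {n} = record
  { bijection  = ↔-id ℤ
  ; periodic   = λ _ → refl
  ; normalised = ∑-window n
  }

-- (v ∙ w) ⟨ i ⟩ = v ⟨ w ⟨ i ⟩ ⟩
_∙_ : ∀ {n} → AffinePermutation n → AffinePermutation n → AffinePermutation n
_∙_ {n} v w = record
  { bijection  = bijection v ↔-∘ bijection w
  ; periodic   = λ i → trans (cong (v ⟨_⟩) (periodic w i)) (periodic v (w ⟨ i ⟩))
  ; normalised = +-cancelʳ (∑[ k < n ] window k) _ _ (trans
      (sum-∘ n (bijection w) (periodic w) (v ⟨_⟩) (periodic v))
      (cong₂ _+_ (normalised v) (trans (normalised w) (sym (∑-window n)))))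
  }

_⁻¹ : ∀ {n} → AffinePermutation n → AffinePermutation n
_⁻¹ {n} w = record
  { bijection  = ↔-sym p
  ; periodic   = from-periodic p (periodic w)
  ; normalised = trans (+-cancelʳ (∑[ k < n ] to p (window k)) _ _ (begin
      ∑[ k < n ] from p (window k) + ∑[ k < n ] to p (window k)
        ≡⟨ sym (sum-∘ n p (periodic w) (from p) (from-periodic p (periodic w))) ⟩
      ∑[ k < n ] from p (to p (window k)) + ∑[ k < n ] window k
        ≡⟨ cong₂ _+_ (sum-cong-≗ {n} (λ k → strictlyInverseʳ p (window k)))
                     (trans (∑-window n) (sym (normalised w))) ⟩
      ∑[ k < n ] window k + ∑[ k < n ] to p (window k) ∎)) (∑-window n)
  }
  where
  open ≡-Reasoning
  p = bijection w

affineSymmetricGroup : ℕ → Group 0ℓ 0ℓ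
affineSymmetricGroup n = record
  { Carrier = AffinePermutation n
  ; _≈_     = _≈_
  ; _∙_     = _∙_
  ; ε       = ε
  ; _⁻¹     = _⁻¹
  ; isGroup = record
    { isMonoid = record
      { isSemigroup = record
        { isMagma = record
          { isEquivalence = record
            { refl  = λ _ → refl
            ; sym   = λ eq i → sym (eq i)
            ; trans = λ eq eq′ i → trans (eq i) (eq′ i)
            }
          ; ∙-cong = λ {u} {_} {_} {w} eq eq′ i → trans (cong (u ⟨_⟩) (eq′ i)) (eq (w ⟨ i ⟩))
          }
        ; assoc = λ _ _ _ _ → refl
        }
      ; identity = (λ _ _ → refl) , (λ _ _ → refl)
      }
    ; inverse = (λ w → strictlyInverseʳ (bijection w)) , (λ w → strictlyInverseˡ (bijection w))
    ; ⁻¹-cong = λ {v} {w} eq i → trans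
        (cong (from (bijection v))
          (trans (sym (strictlyInverseˡ (bijection w) i)) (sym (eq (w ⁻¹ ⟨ i ⟩)))))
        (strictlyInverseʳ (bijection v) (w ⁻¹ ⟨ i ⟩))
    }
  }

-- s is the simple generator s̃ᵢ with i = window k.  For n = 1 no permutation satisfies
-- this: the group is trivial and has an empty set of simple generators.
record IsSimpleGenerator {n} (k : Fin n) (s : AffinePermutation n) : Set where
  field
    raises : ∀ m → s ⟨ window k + m * + n ⟩ ≡ window k + m * + n + + 1
    lowers : ∀ m → s ⟨ window k + m * + n + + 1 ⟩ ≡ window k + m * + n
    fixes  : ∀ j → (∀ m → j ≢ window k + m * + n) → (∀ m → j ≢ window k + m * + n + + 1) →
             s ⟨ j ⟩ ≡ j

IsSimple : ∀ {n} → AffinePermutation n → Set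
IsSimple s = ∃[ k ] IsSimpleGenerator k s

IsWordFor : ∀ {n} → AffinePermutation n → List (AffinePermutation n) → Set
IsWordFor w ss = All IsSimple ss × foldr _∙_ ε ss ≈ w

-- The Coxeter length of w is ℓ.
HasLength : ∀ {n} → AffinePermutation n → ℕ → Set
HasLength w ℓ = (∃[ ss ] IsWordFor w ss × length ss ≡ ℓ) ×
                (∀ ss → IsWordFor w ss → ℓ ℕ.≤ length ss)

infix 4 _≤L_

_≤L_ : ∀ {n} → AffinePermutation n → AffinePermutation n → Set
x ≤L y = ∃[ ℓx ] ∃[ ℓy ] ∃[ ℓyx⁻¹ ]
  HasLength x ℓx × HasLength y ℓy × HasLength (y ∙ x ⁻¹) ℓyx⁻¹ × + ℓyx⁻¹ ≡ + ℓy - + ℓx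

-- Positions i and j, in either order, are incomparable in the descendant order of w.
Incomparable : ∀ {n} → AffinePermutation n → ℤ → ℤ → Set
Incomparable w i j = ∃[ k ] i ⊓ j < k × k < i ⊔ j × w ⟨ i ⟩ ⊔ w ⟨ j ⟩ < w ⟨ k ⟩

-- i ≼_w j
_⊢_≼_ : ∀ {n} → AffinePermutation n → ℤ → ℤ → Set
w ⊢ i ≼ j = ¬ Incomparable w i j × w ⟨ i ⟩ ≤ w ⟨ j ⟩

infix 4 _≡syl_

_≡syl_ : ∀ {n} → AffinePermutation n → AffinePermutation n → Set
v ≡syl w = ∀ i j → (v ⊢ i ≼ j) ⇔ (w ⊢ i ≼ j)

IsMinimalInClass : ∀ {n} → AffinePermutation n → AffinePermutation n → Set
IsMinimalInClass w m = m ≡syl w × (∀ v → v ≡syl w → v ≤L m → v ≈ m)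

-- The graph of π↓: m is the unique minimal element of the class of w.
π↓[_]↦_ : ∀ {n} → AffinePermutation n → AffinePermutation n → Set
π↓[ w ]↦ m = IsMinimalInClass w m × (∀ m′ → IsMinimalInClass w m′ → m′ ≈ m)

-- The graph of the affine stack-sorting map.
s̃[_]↦_ : ∀ {n} → AffinePermutation n → AffinePermutation n → Set
s̃[ w ]↦ u = ∃[ m ] π↓[ w ]↦ m × u ≈ w ∙ m ⁻¹

OneStackSortable : ∀ {n} → AffinePermutation n → Set
OneStackSortable w = s̃[ w ]↦ ε

Avoids231 : ∀ {n} → AffinePermutation n → Set
Avoids231 w = ¬ (∃[ i ] ∃[ j ] ∃[ k ] i < j × j < k × w ⟨ k ⟩ < w ⟨ i ⟩ × w ⟨ i ⟩ < w ⟨ j ⟩)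

-- Two one-stack-sortable elements are equal when their underlying permutations are,
-- irrespective of the proofs of sortability.
oneStackSortables : ℕ → Setoid 0ℓ 0ℓ
oneStackSortables n = record
  { Carrier       = ∃[ w ] OneStackSortable {n} w
  ; _≈_           = _≈_ on proj₁
  ; isEquivalence = On.isEquivalence proj₁ (Group.isEquivalence (affineSymmetricGroup n))
  }

{-# OPTIONS --safe #-}

-- Coxeter length is Shi's count of inversions modulo translation by n, so a simple generator
-- changes it by one and inclusion of inversion sets bounds it.  If w contains 231 then it contains
-- an occurrence i < j < k with w i = 1 + w k, and exchanging these two values gives a shorter
-- element of the same class, below w.  Conversely, the inversions of a 231-avoiding w are
-- comparable pairs, hence inversions of every element of its class, so w is minimal in it.
--
-- For the count, a 231-avoiding w is determined by its suffix minima S i = min { w j | j ≥ i }: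
-- read w as a stack, then S i is, up to a constant, the number of pops before the i-th push.  Up to
-- translation, S may be any monotone map with S (i + n) = S i + n, that is, any composition of n
-- into n parts S (i + 1) - S i ≥ 0, of which there are C(2n - 1, n).

module Submission where

open import Defs
open import Data.Empty using (⊥)
open import Data.Fin.Base using (Fin; toℕ)
import Data.Fin.Base as Fin
open import Data.Fin.Properties using (any?; +↔⊎)
import Data.Fin.Properties as Fin
open import Data.Integer.Base hiding (suc; pos; _*_; NonZero)
import Data.Integer.Base as ℤ
open import Data.Integer.DivMod using (_%ℕ_; _/ℕ_; n%ℕd<d; a≡a%ℕn+[a/ℕn]*n)
open import Data.Integer.Properties
open import Data.Integer.Tactic.RingSolver using (solve-∀)
open import Data.List.Base using ([]; _∷_; foldr; length)
open import Data.List.Relation.Unary.All using ([]; _∷_)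
open import Data.Nat.Base using (ℕ; zero; suc; NonZero; _*_; _∸_)
import Data.Nat.Base as ℕ
open import Data.Nat.Combinatorics using (_C_; nCk+nC[k+1]≡[n+1]C[k+1]; nCn≡1)
import Data.Nat.DivMod as ℕ
import Data.Nat.Properties as ℕ
open import Data.Product.Base using (∃; ∃-syntax; _×_; _,_; proj₁; proj₂)
open import Data.Sum.Base using (_⊎_; inj₁; inj₂)
open import Data.Sum.Function.Propositional using (_⊎-↔_)
open import Data.Vec.Base using (Vec; []; _∷_; lookup; tabulate)
import Data.Vec.Base as Vec
open import Data.Vec.Properties using (lookup∘tabulate; tabulate∘lookup; tabulate-cong)
open import Function.Base using (_∘_)
open import Function.Bundles using (_↔_; _⇔_; Inverse; Equivalence; mk↔ₛ′; mk⇔)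
open import Function.Construct.Composition using (_↔-∘_; inverse)
open import Relation.Binary.Definitions using (tri<; tri≈; tri>)
open import Relation.Binary.PropositionalEquality
open import Relation.Nullary using (¬_; Dec; yes; no; contradiction)

open import Algebra.Properties.CommutativeMonoid.Sum +-0-commutativeMonoid using (sum-syntax; sum-cong-≗; ∑-distrib-+; sum-permute)
open import Algebra.Properties.Monoid.Sum ℕ.+-0-monoid using () renaming (sum to sumℕ)

open AffinePermutation
open Inverse using (to; from; strictlyInverseˡ; strictlyInverseʳ)
open Reindexing

-- Coxeter length and the weak order are stated through all words in the generators, so the length
-- formula has to come first; a lower bound valid for every word meets a word built by removing left
-- descents. An exchange of adjacent values stays in its class because the entry between the two
-- positions exceeds both values and makes the positions incomparable before and after. Sortability
-- includes uniqueness of the minimal element, which holds because two 231-avoiding elements of one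
-- class contain each other's inversions. A composition gives the suffix minima only up to an
-- additive constant, which the prescribed window sum then fixes.

infixr 8 1+_

-- Adding on the left makes `1+_` compute on constructors, so the clauses of `constant` and the
-- first one of `accumulate-step` need no rewriting.
1+_ : ℤ → ℤ
1+ i = + 1 + i

-- Integer inequalities, propagation along unit steps, and bounded search.

module Arithmetic where

  -- Inequalities are compared through their differences, which leaves a ring identity for the
  -- solver.
  ≤-diff : ∀ {a b c d} → a ≤ b → b - a ≡ d - c → c ≤ d
  ≤-diff a≤b eq = 0≤i-j⇒j≤i (subst (+ 0 ≤_) eq (i≤j⇒0≤j-i a≤b))

  1+≤⇒< : ∀ {i j} → 1+ i ≤ j → i < j
  1+≤⇒< = suc[i]≤j⇒i<j

  <⇒1+≤ : ∀ {i j} → i < j → 1+ i ≤ j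
  <⇒1+≤ = i<j⇒suc[i]≤j

  <-diff : ∀ {a b c d} → a < b → b - a ≡ d - c → c < d
  <-diff {a} {b} {c} {d} a<b eq =
    1+≤⇒< (≤-diff (<⇒1+≤ a<b) (trans (dec a b) (trans (cong (_- + 1) eq) (sym (dec c d)))))
    where
    dec : ∀ a b → b - (+ 1 + a) ≡ (b - a) - + 1
    dec = solve-∀

  ≤⇒<1+ : ∀ {i j} → i ≤ j → i < 1+ j
  ≤⇒<1+ i≤j = 1+≤⇒< (+-monoʳ-≤ (+ 1) i≤j)

  <1+⇒≤ : ∀ {i j} → i < 1+ j → i ≤ j
  <1+⇒≤ {i} {j} i<1+j = ≤-diff (<⇒1+≤ i<1+j) (lemma i j)
    where
    lemma : ∀ i j → + 1 + j - (+ 1 + i) ≡ j - i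
    lemma = solve-∀

  <1+ : ∀ i → i < 1+ i
  <1+ i = ≤⇒<1+ ≤-refl

  1+-injective : ∀ {i j} → 1+ i ≡ 1+ j → i ≡ j
  1+-injective {i} {j} eq = trans (lemma i) (trans (cong (_- + 1) eq) (sym (lemma j)))
    where
    lemma : ∀ i → i ≡ + 1 + i - + 1
    lemma = solve-∀

  ≤⇒offset : ∀ {i j} → i ≤ j → ∃[ d ] j ≡ i + + d
  ≤⇒offset {i} {j} i≤j = ∣ j - i ∣ , trans (lemma i j) (cong (λ x → i + x) (sym (0≤i⇒+∣i∣≡i (i≤j⇒0≤j-i i≤j))))
    where
    lemma : ∀ i j → j ≡ i + (j - i)
    lemma = solve-∀

  <⇒offset : ∀ {i j} → i < j → ∃[ d ] j ≡ 1+ (i + + d)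
  <⇒offset {i} i<j with d , refl ← ≤⇒offset (<⇒1+≤ i<j) = d , +-assoc (+ 1) i (+ d)

  +1+ : ∀ i k → i + + suc k ≡ 1+ (i + + k)
  +1+ i k = lemma i (+ k)
    where
    lemma : ∀ i k → i + (+ 1 + k) ≡ + 1 + (i + k)
    lemma = solve-∀

  1++ : ∀ i k → i + + suc k ≡ 1+ i + + k
  1++ i k = lemma i (+ k)
    where
    lemma : ∀ i k → i + (+ 1 + k) ≡ + 1 + i + k
    lemma = solve-∀

  +-shuffle : ∀ i j k → i + j + k ≡ i + k + j
  +-shuffle = solve-∀

  +-cancelʳ : ∀ k {i j} → i + k ≡ j + k → i ≡ j
  +-cancelʳ k {i} {j} eq = trans (lemma i k) (trans (cong (_- k) eq) (sym (lemma j k)))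
    where
    lemma : ∀ i k → i ≡ i + k - k
    lemma = solve-∀

  +-cancelʳ-< : ∀ k {i j} → i + k < j + k → i < j
  +-cancelʳ-< k {i} {j} lt = <-diff lt (lemma i j k)
    where
    lemma : ∀ i j k → j + k - (i + k) ≡ j - i
    lemma = solve-∀

  monotone : ∀ {f : ℤ → ℤ} → (∀ i → f i ≤ f (1+ i)) → ∀ {i j} → i ≤ j → f i ≤ f j
  monotone {f} step {i} i≤j with d , refl ← ≤⇒offset i≤j = go d
    where
    go : ∀ d → f i ≤ f (i + + d)
    go zero    = ≤-reflexive (cong f (sym (+-identityʳ i)))
    go (suc d) = subst (λ j → f i ≤ f j) (sym (+1+ i d)) (≤-trans (go d) (step _))

  constant : ∀ {A : Set} {f : ℤ → A} → (∀ i → f (1+ i) ≡ f i) → ∀ i → f i ≡ f (+ 0)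
  constant         step (+ zero)       = refl
  constant         step (+ suc k)      = trans (step (+ k)) (constant step (+ k))
  constant         step -[1+ zero ]    = sym (step -[1+ 0 ])
  constant {f = f} step -[1+ suc k ]   = trans (sym (step -[1+ suc k ])) (constant step -[1+ k ])

  least : ∀ {Q : ℕ → Set} → (∀ k → Dec (Q k)) → ∀ b → Q b →
          ∃[ l ] Q l × (∀ k → k ℕ.< l → ¬ Q k)
  least Q? b Qb with Q? 0
  ... | yes Q0 = 0 , Q0 , λ _ ()
  ... | no ¬Q0 with b
  ...   | zero   = contradiction Qb ¬Q0
  ...   | suc b′ with l , Ql , below ← least (Q? ∘ suc) b′ Qb =
    suc l , Ql , λ { zero _ → ¬Q0 ; (suc k) (ℕ.s≤s k<l) → below k k<l }

open Arithmetic

module AffineRank (m : ℕ) where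
  open Residues m using (n; residue; res; window-unique; induced)

  -- Inversions of affine permutations

  shift-periodic′ : ∀ (w : AffinePermutation n) i q → w ⟨ i + q ℤ.* + n ⟩ ≡ w ⟨ i ⟩ + q ℤ.* + n
  shift-periodic′ w = shift-periodic {n} {w ⟨_⟩} (periodic w)

  to-injective : ∀ (p : ℤ ↔ ℤ) {i j} → to p i ≡ to p j → i ≡ j
  to-injective p {i} {j} eq =
    trans (sym (strictlyInverseʳ p i)) (trans (cong (from p) eq) (strictlyInverseʳ p j))

  ∑-const : ∀ k c → ∑[ _ < k ] c ≡ + k ℤ.* c
  ∑-const zero    c = sym (*-zeroˡ c)
  ∑-const (suc k) c = trans (cong (λ x → c + x) (∑-const k c)) (lemma c (+ k))
    where
    lemma : ∀ c k → c + k ℤ.* c ≡ (+ 1 + k) ℤ.* c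
    lemma = solve-∀

  -- Summing the hypothesis over a window leaves `n c = 0`, as both window sums are the same; and
  -- `n` is a successor.
  translation-trivial : ∀ (v w : AffinePermutation n) {c} → (∀ i → v ⟨ i ⟩ ≡ w ⟨ i ⟩ + c) → c ≡ + 0
  translation-trivial v w {c} eq with i*j≡0⇒i≡0∨j≡0 (+ n) nc≡0
    where
    W = ∑[ k < n ] w ⟨ window k ⟩
    lemma : ∀ x y → y ≡ x + y - x
    lemma = solve-∀
    nc≡0 : + n ℤ.* c ≡ + 0
    nc≡0 = begin
      + n ℤ.* c                            ≡⟨ lemma W (+ n ℤ.* c) ⟩
      W + + n ℤ.* c - W                    ≡⟨ cong (λ x → W + x - W) (sym (∑-const n c)) ⟩
      W + ∑[ _ < n ] c - W
        ≡⟨ cong (_- W) (sym (∑-distrib-+ {n} (λ k → w ⟨ window k ⟩) (λ _ → c))) ⟩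
      ∑[ k < n ] (w ⟨ window k ⟩ + c) - W
        ≡⟨ cong (_- W) (sum-cong-≗ {n} (λ k → sym (eq (window k)))) ⟩
      ∑[ k < n ] v ⟨ window k ⟩ - W
        ≡⟨ cong (_- W) (trans (normalised v) (sym (normalised w))) ⟩
      W - W                                ≡⟨ +-inverseʳ W ⟩
      + 0                                  ∎
      where open ≡-Reasoning
  ... | inj₂ c≡0 = c≡0

  -- The displacement `u i - i` cannot decrease and repeats after `n` steps, so it is constant;
  -- normalisation makes the constant zero.
  increasing⇒≈ε : ∀ (u : AffinePermutation n) → (∀ i → u ⟨ i ⟩ < u ⟨ 1+ i ⟩) → u ≈ ε
  increasing⇒≈ε u inc i = trans (u≡i+c i)
    (trans (cong (λ x → i + x) (translation-trivial u ε u≡i+c)) (+-identityʳ i))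
    where
    d : ℤ → ℤ
    d = displacement (u ⟨_⟩)
    d-step : ∀ i → d i ≤ d (1+ i)
    d-step i = ≤-diff (<⇒1+≤ (inc i)) (lemma (u ⟨ i ⟩) (u ⟨ 1+ i ⟩) i)
      where
      lemma : ∀ a b i → b - (+ 1 + a) ≡ b - (+ 1 + i) - (a - i)
      lemma = solve-∀
    1+i≤i+n : ∀ i → 1+ i ≤ i + + n
    1+i≤i+n i = subst (1+ i ≤_) (sym (1++ i m)) (i≤i+j (1+ i) (+ m))
    d-const : ∀ i → d (1+ i) ≡ d i
    d-const i = ≤-antisym
      (≤-trans (monotone {d} d-step (1+i≤i+n i))
               (≤-reflexive (displacement-invariant {n} {u ⟨_⟩} (periodic u) i)))
      (d-step i)
    u≡i+c : ∀ i → u ⟨ i ⟩ ≡ i + d (+ 0)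
    u≡i+c i = trans (lemma (u ⟨ i ⟩) i) (cong (λ x → i + x) (constant {f = d} d-const i))
      where
      lemma : ∀ x i → x ≡ i + (x - i)
      lemma = solve-∀

  _⊆Inv_ : AffinePermutation n → AffinePermutation n → Set
  v ⊆Inv w = ∀ {i j} → i < j → v ⟨ j ⟩ < v ⟨ i ⟩ → w ⟨ j ⟩ < w ⟨ i ⟩

  -- It suffices that `v w⁻¹` increases at every step. If the positions of `i` and `i + 1` in `w`
  -- are inverted, `v` inverts them too; if not, `v` cannot invert them.
  inversions-determine : ∀ (v w : AffinePermutation n) → v ⊆Inv w → w ⊆Inv v → v ≈ w
  inversions-determine v w v⊆w w⊆v i =
    trans (cong (v ⟨_⟩) (sym (strictlyInverseʳ (bijection w) i)))
          (increasing⇒≈ε (v ∙ w ⁻¹) increasing (w ⟨ i ⟩))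
    where
    increasing : ∀ i → (v ∙ w ⁻¹) ⟨ i ⟩ < (v ∙ w ⁻¹) ⟨ 1+ i ⟩
    increasing i with <-cmp p q
      where
      p = w ⁻¹ ⟨ i ⟩
      q = w ⁻¹ ⟨ 1+ i ⟩
    ... | tri≈ _ p≡q _ = contradiction (to-injective (bijection (w ⁻¹)) p≡q) (<⇒≢ (<1+ i))
    ... | tri> _ _ q<p = w⊆v q<p (subst₂ _<_ (sym (strictlyInverseˡ (bijection w) i))
                                             (sym (strictlyInverseˡ (bijection w) (1+ i))) (<1+ i))
    ... | tri< p<q _ _ with <-cmp (v ⟨ w ⁻¹ ⟨ i ⟩ ⟩) (v ⟨ w ⁻¹ ⟨ 1+ i ⟩ ⟩)
    ...   | tri< lt _ _ = lt
    ...   | tri≈ _ eq _ = contradiction (to-injective (bijection v) eq) (<⇒≢ p<q)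
    ...   | tri> _ _ gt = contradiction (<1+ i) (<-asym
      (subst₂ _<_ (strictlyInverseˡ (bijection w) (1+ i)) (strictlyInverseˡ (bijection w) i)
                  (v⊆w p<q gt)))

  translation : ℤ → ℤ ↔ ℤ
  translation c = mk↔ₛ′ (_+ c) (_- c) (λ i → sub-add i c) (λ i → add-sub i c)
    where
    sub-add : ∀ i c → i - c + c ≡ i
    sub-add = solve-∀
    add-sub : ∀ i c → i + c - c ≡ i
    add-sub = solve-∀

  -- Coxeter length

  -- The condition `b + u n < a` says `u n ≤ a - b - 1`, so `q` is the floor of `(a - b - 1) / n`.
  greatestBelow : ∀ a b → ∃[ q ] (∀ {u} → b + u ℤ.* + n < a → u ≤ q) × (∀ {u} → u ≤ q → b + u ℤ.* + n < a)
  greatestBelow a b = q , upper , lower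
    where
    x q : ℤ
    x = a - b - + 1
    q = x /ℕ n
    r : ℕ
    r = x %ℕ n
    x≡ : x ≡ + r + q ℤ.* + n
    x≡ = a≡a%ℕn+[a/ℕn]*n x n
    upper : ∀ {u} → b + u ℤ.* + n < a → u ≤ q
    upper {u} b+un<a = ≮⇒≥ λ q<u → <⇒≱ (+<+ (n%ℕd<d x n)) (n≤r q<u)
      where
      n≤r : q < u → + n ≤ + r
      n≤r q<u = ≤-diff
        (+-mono-≤ (*-monoʳ-≤-nonNeg (+ n) (<⇒1+≤ q<u)) (+-mono-≤ (<⇒1+≤ b+un<a) (≤-reflexive x≡)))
        (lemma a b (u ℤ.* + n) q (+ r) (+ n))
        where
        lemma : ∀ a b y q r n →
                (y + (a + (r + q ℤ.* n))) - ((+ 1 + q) ℤ.* n + (+ 1 + (b + y) + (a - b - + 1))) ≡ r - n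
        lemma = solve-∀
    lower : ∀ {u} → u ≤ q → b + u ℤ.* + n < a
    lower {u} u≤q = 1+≤⇒< (≤-diff
      (+-mono-≤ (*-monoʳ-≤-nonNeg (+ n) u≤q) (+-mono-≤ (+≤+ (ℕ.z≤n {r})) (≤-reflexive (sym x≡))))
      (lemma a b (u ℤ.* + n) (q ℤ.* + n) (+ r)))
      where
      lemma : ∀ a b y z r → (z + (r + (a - b - + 1))) - (y + (+ 0 + (r + z))) ≡ a - (+ 1 + (b + y))
      lemma = solve-∀

  abstract

    lastBelow : ℤ → ℤ → ℤ
    lastBelow a b = proj₁ (greatestBelow a b)

    lastBelow-≥ : ∀ {a b} u → b + u ℤ.* + n < a → u ≤ lastBelow a b
    lastBelow-≥ {a} {b} u = proj₁ (proj₂ (greatestBelow a b))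

    lastBelow-≤ : ∀ {a b} u → u ≤ lastBelow a b → b + u ℤ.* + n < a
    lastBelow-≤ {a} {b} u = proj₂ (proj₂ (greatestBelow a b))

  positivePart : ℤ → ℕ
  positivePart (+ k)    = k
  positivePart -[1+ _ ] = 0

  positivePart-≤0 : ∀ {x} → x ≤ + 0 → positivePart x ≡ 0
  positivePart-≤0 (+≤+ ℕ.z≤n) = refl
  positivePart-≤0 -≤+         = refl

  positivePart-mono : ∀ {x y} → x ≤ y → positivePart x ℕ.≤ positivePart y
  positivePart-mono (+≤+ x≤y) = x≤y
  positivePart-mono -≤+       = ℕ.z≤n
  positivePart-mono (-≤- _)   = ℕ.z≤n

  positivePart-1+ : ∀ x → + 0 ≤ x → positivePart (1+ x) ≡ suc (positivePart x)
  positivePart-1+ _ (+≤+ _) = refl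

  -- The number of inversions (window i, window j + u n) of w with u ∈ ℤ.
  inversionsAt : AffinePermutation n → Fin n → Fin n → ℕ
  inversionsAt w i j = positivePart
    (lastBelow (w ⟨ window i ⟩) (w ⟨ window j ⟩) - lastBelow (1+ window i) (window j))

  -- Every inversion has exactly one translate whose left end lies in the window, so the sum over
  -- pairs of residues counts inversions modulo translation.
  len : AffinePermutation n → ℕ
  len w = sumℕ λ i → sumℕ λ j → inversionsAt w i j

  sumℕ-mono : ∀ {k} {f g : Fin k → ℕ} → (∀ i → f i ℕ.≤ g i) → sumℕ f ℕ.≤ sumℕ g
  sumℕ-mono {zero}  f≤g = ℕ.z≤n
  sumℕ-mono {suc k} f≤g = ℕ.+-mono-≤ (f≤g Fin.zero) (sumℕ-mono (f≤g ∘ Fin.suc))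

  sumℕ-cong : ∀ {k} {f g : Fin k → ℕ} → (∀ i → f i ≡ g i) → sumℕ f ≡ sumℕ g
  sumℕ-cong {zero}  f≡g = refl
  sumℕ-cong {suc k} f≡g = cong₂ ℕ._+_ (f≡g Fin.zero) (sumℕ-cong (f≡g ∘ Fin.suc))

  sumℕ-suc : ∀ {k} {f g : Fin k → ℕ} i → f i ≡ suc (g i) → (∀ j → j ≢ i → f j ≡ g j) →
             sumℕ f ≡ suc (sumℕ g)
  sumℕ-suc Fin.zero    fi≡ f≡g =
    cong₂ ℕ._+_ fi≡ (sumℕ-cong λ j → f≡g (Fin.suc j) λ ())
  sumℕ-suc {g = g} (Fin.suc i) fi≡ f≡g = trans
    (cong₂ ℕ._+_ (f≡g Fin.zero λ ()) (sumℕ-suc i fi≡ λ j j≢i → f≡g (Fin.suc j) (j≢i ∘ Fin.suc-injective)))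
    (ℕ.+-suc (g Fin.zero) _)

  -- The counted `u` run from just after `u₀` to the last translate of lower value. If there are
  -- any, the last one is an inversion of `v`, hence of `w`, and this one alone bounds the count for
  -- `w` from below.
  inversionsAt-mono : ∀ v w i j →
    (∀ u → window i < window j + u ℤ.* + n →
       v ⟨ window j + u ℤ.* + n ⟩ < v ⟨ window i ⟩ → w ⟨ window j + u ℤ.* + n ⟩ < w ⟨ window i ⟩) →
    inversionsAt v i j ℕ.≤ inversionsAt w i j
  inversionsAt-mono v w i j v⊆w = compare (u ≤? u₀)
    where
    u₀ u : ℤ
    u₀ = lastBelow (1+ window i) (window j)
    u = lastBelow (v ⟨ window i ⟩) (v ⟨ window j ⟩)
    compare : Dec (u ≤ u₀) → inversionsAt v i j ℕ.≤ inversionsAt w i j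
    compare (yes u≤u₀) = subst (ℕ._≤ _) (sym (positivePart-≤0 (i≤j⇒i-j≤0 u≤u₀))) ℕ.z≤n
    compare (no  u≰u₀) = positivePart-mono (+-monoˡ-≤ (- u₀)
      (lastBelow-≥ u (subst (_< w ⟨ window i ⟩) (shift-periodic′ w (window j) u)
        (v⊆w u (≰⇒> λ le → u≰u₀ (lastBelow-≥ u (≤⇒<1+ le)))
               (subst (_< v ⟨ window i ⟩) (sym (shift-periodic′ v (window j) u)) (lastBelow-≤ u ≤-refl))))))

  len-mono : ∀ v w → v ⊆Inv w → len v ℕ.≤ len w
  len-mono v w v⊆w =
    sumℕ-mono λ i → sumℕ-mono λ j → inversionsAt-mono v w i j (λ _ i<j → v⊆w i<j)

  len-cong : ∀ v w → v ≈ w → len v ≡ len w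
  len-cong v w v≈w = ℕ.≤-antisym
    (len-mono v w λ {i} {j} _ → subst₂ _<_ (v≈w j) (v≈w i))
    (len-mono w v λ {i} {j} _ → subst₂ _<_ (sym (v≈w j)) (sym (v≈w i)))

  len-ε : len ε ≡ 0
  len-ε = trans (sumℕ-cong {n} λ i → trans (sumℕ-cong {n} (zeros i)) (sum-zero n)) (sum-zero n)
    where
    zeros : ∀ i j → inversionsAt ε i j ≡ 0
    zeros i j = positivePart-≤0 (i≤j⇒i-j≤0
      (lastBelow-≥ u (<-trans (lastBelow-≤ {window i} {window j} u ≤-refl) (<1+ (window i)))))
      where
      u = lastBelow (window i) (window j)
    sum-zero : ∀ k → sumℕ {k} (λ _ → 0) ≡ 0
    sum-zero zero    = refl
    sum-zero (suc k) = sum-zero k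

  -- v arises from w by exchanging the values w y, w x = 1 + w y and their n-translates.
  record Exchange (w v : AffinePermutation n) (x y : ℤ) : Set where
    field
      1<n : 1 ℕ.< n
      w-adjacent : w ⟨ x ⟩ ≡ 1+ (w ⟨ y ⟩)
      v-adjacent : v ⟨ y ⟩ ≡ 1+ (v ⟨ x ⟩)
      w⇒v : ∀ p q → w ⟨ p ⟩ < w ⟨ q ⟩ →
            v ⟨ p ⟩ < v ⟨ q ⟩ ⊎ ∃[ t ] p ≡ y + t ℤ.* + n × q ≡ x + t ℤ.* + n
      v⇒w : ∀ p q → v ⟨ p ⟩ < v ⟨ q ⟩ →
            w ⟨ p ⟩ < w ⟨ q ⟩ ⊎ ∃[ t ] p ≡ x + t ℤ.* + n × q ≡ y + t ℤ.* + n

  -- Lets each consequence of an exchange serve in the opposite direction, as when a generator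
  -- lengthens `w`.
  exchange-sym : ∀ {w v x y} → Exchange w v x y → Exchange v w y x
  exchange-sym ex = record
    { 1<n = 1<n ; w-adjacent = v-adjacent ; v-adjacent = w-adjacent ; w⇒v = v⇒w ; v⇒w = w⇒v }
    where open Exchange ex

  exchange-⊆Inv : ∀ {w v x y} → Exchange w v x y → x < y → v ⊆Inv w
  exchange-⊆Inv {x = x} {y} ex x<y {i} {j} i<j vj<vi with Exchange.v⇒w ex j i vj<vi
  ... | inj₁ wj<wi = wj<wi
  ... | inj₂ (t , refl , refl) = contradiction (+-cancelʳ-< (t ℤ.* + n) i<j) (<-asym x<y)

  -- Only translates of the pair `(x, y)` change order, and they are all counted in the entry at the
  -- residues of `x` and `y`, which drops by exactly one.
  len-exchange′ : ∀ {w v x y} → Exchange w v x y → x < y →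
                  ∀ i₀ α → x ≡ window i₀ + α ℤ.* + n → ∀ j₀ β → y ≡ window j₀ + β ℤ.* + n →
                  len w ≡ suc (len v)
  len-exchange′ {w} {v} {x} {y} ex x<y i₀ α x≡ j₀ β y≡ =
    sumℕ-suc i₀ (sumℕ-suc j₀ at-i₀j₀ (λ j j≢j₀ → elsewhere i₀ j λ _ → j≢j₀))
                (λ i i≢i₀ → sumℕ-cong λ j → elsewhere i j λ i≡i₀ → contradiction i≡i₀ i≢i₀)
    where
    open Exchange ex

    elsewhere : ∀ i j → (i ≡ i₀ → j ≢ j₀) → inversionsAt w i j ≡ inversionsAt v i j
    elsewhere i j ij≢ = ℕ.≤-antisym (inversionsAt-mono w v i j kept)
                                    (inversionsAt-mono v w i j (λ _ → exchange-⊆Inv ex x<y))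
      where
      kept : ∀ u → window i < window j + u ℤ.* + n →
             w ⟨ window j + u ℤ.* + n ⟩ < w ⟨ window i ⟩ → v ⟨ window j + u ℤ.* + n ⟩ < v ⟨ window i ⟩
      kept u _ lt with w⇒v (window j + u ℤ.* + n) (window i) lt
      ... | inj₁ v< = v<
      ... | inj₂ (t , j≡ , i≡) = contradiction
        (window-unique j j₀ (β + t - u) (trans (lemma₁ (window j) u (+ n))
          (trans (cong (_- u ℤ.* + n) (trans j≡ (cong (_+ t ℤ.* + n) y≡))) (lemma₂ (window j₀) β t u (+ n)))))
        (ij≢ (window-unique i i₀ (α + t) (trans i≡ (trans (cong (_+ t ℤ.* + n) x≡)
          (lemma₃ (window i₀) α t (+ n))))))
        where
        lemma₁ : ∀ j u n → j ≡ j + u ℤ.* n - u ℤ.* n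
        lemma₁ = solve-∀
        lemma₂ : ∀ j β t u n → j + β ℤ.* n + t ℤ.* n - u ℤ.* n ≡ j + (β + t - u) ℤ.* n
        lemma₂ = solve-∀
        lemma₃ : ∀ i α t n → i + α ℤ.* n + t ℤ.* n ≡ i + (α + t) ℤ.* n
        lemma₃ = solve-∀

    i j u : ℤ
    i = window i₀
    j = window j₀
    -- Translating `(x, y)` by `- α n` moves `x` into the window and `y` to `j + u n`.
    u = β - α
    u₀ : ℤ
    u₀ = lastBelow (1+ i) j

    value : ∀ w → w ⟨ j ⟩ + β ℤ.* + n ≡ w ⟨ y ⟩ × w ⟨ i ⟩ + α ℤ.* + n ≡ w ⟨ x ⟩
    value w = trans (sym (shift-periodic′ w j β)) (cong (w ⟨_⟩) (sym y≡)) ,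
              trans (sym (shift-periodic′ w i α)) (cong (w ⟨_⟩) (sym x≡))

    -- Since `x < y`, the pair lies beyond `u₀`; this keeps `positivePart` from truncating the
    -- decrease.
    u₀<u : u₀ < u
    u₀<u = ≰⇒> λ u≤u₀ → <⇒≱ x<y (y≤x (<1+⇒≤ (lastBelow-≤ u u≤u₀)))
      where
      y≤x : j + u ℤ.* + n ≤ i → y ≤ x
      y≤x le = subst₂ _≤_ (sym y≡) (sym x≡) (≤-diff le (lemma i j α β (+ n)))
        where
        lemma : ∀ i j α β n → i - (j + (β - α) ℤ.* n) ≡ (i + α ℤ.* n) - (j + β ℤ.* n)
        lemma = solve-∀

    last : ∀ w k → w ⟨ y ⟩ + k ℤ.* + n < w ⟨ x ⟩ → w ⟨ x ⟩ ≤ w ⟨ y ⟩ + (1+ k) ℤ.* + n →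
           lastBelow (w ⟨ i ⟩) (w ⟨ j ⟩) ≡ u + k
    last w k above below = ≤-antisym
      (<1+⇒≤ (≰⇒> λ 1+u+k≤ → <⇒≱ (lastBelow-≤ _ 1+u+k≤)
        (≤-diff below (trans (neg-sub (w ⟨ x ⟩) _)
          (trans (cong -_ (move (1+ k))) (trans (cong (λ c → - (w ⟨ i ⟩ - (w ⟨ j ⟩ + c ℤ.* + n))) (commute u k))
            (sym (neg-sub (w ⟨ i ⟩) _))))))))
      (lastBelow-≥ (u + k) (<-diff above (move k)))
      where
      commute : ∀ u k → u + (+ 1 + k) ≡ + 1 + (u + k)
      commute = solve-∀
      neg-sub : ∀ a b → b - a ≡ - (a - b)
      neg-sub = solve-∀
      move : ∀ k → w ⟨ x ⟩ - (w ⟨ y ⟩ + k ℤ.* + n) ≡ w ⟨ i ⟩ - (w ⟨ j ⟩ + (u + k) ℤ.* + n)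
      move k = trans
        (cong₂ (λ a b → a - (b + k ℤ.* + n)) (sym (proj₂ (value w))) (sym (proj₁ (value w))))
        (lemma (w ⟨ i ⟩) (w ⟨ j ⟩) α β k (+ n))
        where
        lemma : ∀ i j α β k n → i + α ℤ.* n - (j + β ℤ.* n + k ℤ.* n) ≡ i - (j + (β - α + k) ℤ.* n)
        lemma = solve-∀

    last-w : lastBelow (w ⟨ i ⟩) (w ⟨ j ⟩) ≡ u + + 0
    last-w = last w (+ 0)
      (subst₂ _<_ (lemma₁ (w ⟨ y ⟩) (+ n)) (sym w-adjacent) (<1+ (w ⟨ y ⟩)))
      (subst₂ _≤_ (sym w-adjacent) (lemma₂ (w ⟨ y ⟩) (+ m)) (i≤i+j (1+ w ⟨ y ⟩) (+ m)))
      where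
      lemma₁ : ∀ y n → y ≡ y + + 0 ℤ.* n
      lemma₁ = solve-∀
      lemma₂ : ∀ y m → + 1 + y + m ≡ y + (+ 1 + + 0) ℤ.* (+ 1 + m)
      lemma₂ = solve-∀

    -- Here `v y` exceeds `v x` by one, so the last translate below `v x` comes one period earlier;
    -- `v y - n < v x` holds because `n > 1`.
    last-v : lastBelow (v ⟨ i ⟩) (v ⟨ j ⟩) ≡ u + -[1+ 0 ]
    last-v = last v -[1+ 0 ]
      (<-diff (+<+ 1<n) (trans (lemma₁ (v ⟨ x ⟩) (+ n))
        (cong (λ z → v ⟨ x ⟩ - (z + -[1+ 0 ] ℤ.* + n)) (sym v-adjacent))))
      (subst (v ⟨ x ⟩ ≤_) (trans (sym v-adjacent) (lemma₂ (v ⟨ y ⟩) (+ n))) (<⇒≤ (<1+ (v ⟨ x ⟩))))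
      where
      lemma₁ : ∀ x n → n - + 1 ≡ x - (+ 1 + x + (- + 1) ℤ.* n)
      lemma₁ = solve-∀
      lemma₂ : ∀ y n → y ≡ y + + 0 ℤ.* n
      lemma₂ = solve-∀

    at-i₀j₀ : inversionsAt w i₀ j₀ ≡ suc (inversionsAt v i₀ j₀)
    at-i₀j₀ = begin
      positivePart (lastBelow (w ⟨ i ⟩) (w ⟨ j ⟩) - u₀)
        ≡⟨ cong (λ l → positivePart (l - u₀)) last-w ⟩
      positivePart (u + + 0 - u₀)
        ≡⟨ cong positivePart (lemma₁ u u₀) ⟩
      positivePart (1+ (u + -[1+ 0 ] - u₀))
        ≡⟨ positivePart-1+ (u + -[1+ 0 ] - u₀) (≤-diff (<⇒1+≤ u₀<u) (lemma₂ u u₀)) ⟩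
      suc (positivePart (u + -[1+ 0 ] - u₀))
        ≡⟨ cong (λ l → suc (positivePart (l - u₀))) (sym last-v) ⟩
      suc (positivePart (lastBelow (v ⟨ i ⟩) (v ⟨ j ⟩) - u₀))  ∎
      where
      open ≡-Reasoning
      lemma₁ : ∀ u u₀ → u + + 0 - u₀ ≡ + 1 + (u + - + 1 - u₀)
      lemma₁ = solve-∀
      lemma₂ : ∀ u u₀ → u - (+ 1 + u₀) ≡ u + - + 1 - u₀ - + 0
      lemma₂ = solve-∀

  len-exchange : ∀ {w v x y} → Exchange w v x y → x < y → len w ≡ suc (len v)
  len-exchange {x = x} {y} ex x<y =
    let i₀ , α , x≡ = residue x
        j₀ , β , y≡ = residue y
    in len-exchange′ ex x<y i₀ α x≡ j₀ β y≡

  -- Simple generators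

  -- For `n = 1` periodicity reads `w (i + 1) = w i + 1`, which leaves no room for a descent.
  descent⇒1<n : ∀ (w : AffinePermutation n) i → w ⟨ 1+ i ⟩ < w ⟨ i ⟩ → 1 ℕ.< n
  descent⇒1<n w i desc = ℕ.≤∧≢⇒< (ℕ.s≤s ℕ.z≤n) λ 1≡n → <-asym desc
    (subst (w ⟨ i ⟩ <_) (sym (trans (cong (w ⟨_⟩) (trans (+-comm (+ 1) i) (cong (λ k → i + + k) 1≡n)))
                                    (trans (periodic w i) (trans (cong (λ k → w ⟨ i ⟩ + + k) (sym 1≡n))
                                                                 (+-comm (w ⟨ i ⟩) (+ 1))))))
           (<1+ (w ⟨ i ⟩)))

  module SimpleGenerator (k : Fin n) where

    K : ℤ → ℤ
    K t = window k + t ℤ.* + n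

    K-shift : ∀ t u → K (t + u) ≡ K t + u ℤ.* + n
    K-shift t u = lemma (window k) t u (+ n)
      where
      lemma : ∀ k t u n → k + (t + u) ℤ.* n ≡ k + t ℤ.* n + u ℤ.* n
      lemma = solve-∀

    K? : ∀ a → (∃[ t ] a ≡ K t) ⊎ (∀ t → a ≢ K t)
    K? a = classify (residue a)
      where
      classify : (∃[ i ] ∃[ q ] a ≡ window i + q ℤ.* + n) → (∃[ t ] a ≡ K t) ⊎ (∀ t → a ≢ K t)
      classify (i , q , a≡) with i Fin.≟ k
      ... | yes refl = inj₁ (q , a≡)
      ... | no  i≢k  = inj₂ λ t a≡K → i≢k (window-unique i k (t - q)
        (trans (lemma₁ (window i) q (+ n))
          (trans (cong (_- q ℤ.* + n) (trans (sym a≡) a≡K)) (lemma₂ (window k) t q (+ n)))))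
        where
        lemma₁ : ∀ x q n → x ≡ x + q ℤ.* n - q ℤ.* n
        lemma₁ = solve-∀
        lemma₂ : ∀ x t q n → x + t ℤ.* n - q ℤ.* n ≡ x + (t - q) ℤ.* n
        lemma₂ = solve-∀

    module _ {s : AffinePermutation n} (gen : IsSimpleGenerator k s) where
      open IsSimpleGenerator gen

      raises′ : ∀ t → s ⟨ K t ⟩ ≡ 1+ K t
      raises′ t = trans (raises t) (+-comm (K t) (+ 1))

      lowers′ : ∀ t → s ⟨ 1+ K t ⟩ ≡ K t
      lowers′ t = trans (cong (s ⟨_⟩) (+-comm (+ 1) (K t))) (lowers t)

      data Kind (a : ℤ) : Set where
        raised  : ∀ t → a ≡ K t → s ⟨ a ⟩ ≡ 1+ a → Kind a
        lowered : ∀ t → a ≡ 1+ K t → 1+ (s ⟨ a ⟩) ≡ a → Kind a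
        fixed   : s ⟨ a ⟩ ≡ a → Kind a

      kind : ∀ a → Kind a
      kind a = classify (K? a) (K? (a - + 1))
        where
        lemma : ∀ x → x ≡ + 1 + (x - + 1)
        lemma = solve-∀
        lemma′ : ∀ x → x + + 1 - + 1 ≡ x
        lemma′ = solve-∀
        classify : (∃[ t ] a ≡ K t) ⊎ (∀ t → a ≢ K t) →
                   (∃[ t ] a - + 1 ≡ K t) ⊎ (∀ t → a - + 1 ≢ K t) → Kind a
        classify (inj₁ (t , a≡)) _ =
          raised t a≡ (trans (cong (s ⟨_⟩) a≡) (trans (raises′ t) (cong 1+_ (sym a≡))))
        classify (inj₂ _) (inj₁ (t , a-1≡)) =
          lowered t a≡ (trans (cong (1+_ ∘ (s ⟨_⟩)) a≡) (trans (cong 1+_ (lowers′ t)) (sym a≡)))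
          where
          a≡ : a ≡ 1+ K t
          a≡ = trans (lemma a) (cong 1+_ a-1≡)
        classify (inj₂ a≢) (inj₂ a-1≢) =
          fixed (fixes a a≢ λ t a≡ → a-1≢ t (trans (cong (_- + 1) a≡) (lemma′ (K t))))

      upper : ∀ a → (∃[ t ] a ≡ K t) × s ⟨ a ⟩ ≡ 1+ a ⊎ s ⟨ a ⟩ ≤ a
      upper a with kind a
      ... | raised t a≡ sa≡  = inj₁ ((t , a≡) , sa≡)
      ... | lowered _ _ sa≡  = inj₂ (subst (s ⟨ a ⟩ ≤_) sa≡ (<⇒≤ (<1+ (s ⟨ a ⟩))))
      ... | fixed sa≡        = inj₂ (≤-reflexive sa≡)

      lower : ∀ a → (∃[ t ] a ≡ 1+ K t) × 1+ (s ⟨ a ⟩) ≡ a ⊎ a ≤ s ⟨ a ⟩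
      lower a with kind a
      ... | raised _ _ sa≡   = inj₂ (subst (a ≤_) (sym sa≡) (<⇒≤ (<1+ a)))
      ... | lowered t a≡ sa≡ = inj₁ ((t , a≡) , sa≡)
      ... | fixed sa≡        = inj₂ (≤-reflexive (sym sa≡))

      upper′ : ∀ a → s ⟨ a ⟩ ≤ 1+ a
      upper′ a with upper a
      ... | inj₁ (_ , sa≡) = ≤-reflexive sa≡
      ... | inj₂ sa≤a      = ≤-trans sa≤a (<⇒≤ (<1+ a))

      lower′ : ∀ a → a ≤ 1+ (s ⟨ a ⟩)
      lower′ a with lower a
      ... | inj₁ (_ , sa≡) = ≤-reflexive (sym sa≡)
      ... | inj₂ a≤sa      = ≤-trans a≤sa (<⇒≤ (<1+ (s ⟨ a ⟩)))

      -- A generator moves each value by at most one, so values at distance two or more cannot pass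
      -- each other, and injectivity keeps them apart. Consecutive values can be reversed only if
      -- the lower one is some `K t`.
      order-kept : ∀ {a b} → a < b → s ⟨ a ⟩ < s ⟨ b ⟩ ⊎ ∃[ t ] a ≡ K t × b ≡ 1+ K t
      order-kept {a} {b} a<b with 1+ a ≟ b
      ... | no 1+a≢b = inj₁ (≤∧≢⇒<
        (≤-trans (upper′ a) (<1+⇒≤ (<-≤-trans (≤∧≢⇒< (<⇒1+≤ a<b) 1+a≢b) (lower′ b))))
        λ eq → <⇒≢ a<b (to-injective (bijection s) eq))
      ... | yes refl with upper a | lower (1+ a)
      ...   | inj₁ ((t , a≡) , _) | _ = inj₂ (t , a≡ , cong 1+_ a≡)
      ...   | inj₂ _    | inj₁ ((t , b≡) , _) = inj₂ (t , 1+-injective b≡ , b≡)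
      ...   | inj₂ sa≤a | inj₂ b≤sb = inj₁ (≤-<-trans sa≤a (<-≤-trans (<1+ a) b≤sb))

      generator⇒1<n : 1 ℕ.< n
      generator⇒1<n = descent⇒1<n s (window k)
        (subst₂ _<_
          (sym (trans (cong (s ⟨_⟩) (lemma₁ (window k) (+ n)))
                      (trans (lowers (+ 0)) (lemma₂ (window k) (+ n)))))
          (sym (trans (cong (s ⟨_⟩) (sym (lemma₂ (window k) (+ n))))
                      (trans (raises (+ 0)) (sym (lemma₁ (window k) (+ n))))))
          (<1+ (window k)))
        where
        lemma₁ : ∀ k n → + 1 + k ≡ k + + 0 ℤ.* n + + 1
        lemma₁ = solve-∀
        lemma₂ : ∀ k n → k + + 0 ℤ.* n ≡ k
        lemma₂ = solve-∀

      involutive : ∀ a → s ⟨ s ⟨ a ⟩ ⟩ ≡ a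
      involutive a with kind a
      ... | raised t refl _  = trans (cong (s ⟨_⟩) (raises′ t)) (lowers′ t)
      ... | lowered t refl _ = trans (cong (s ⟨_⟩) (lowers′ t)) (raises′ t)
      ... | fixed sa≡        = trans (cong (s ⟨_⟩) sa≡) sa≡

      -- By `order-kept` only values `K u` and `1+ K u` can be reversed; periodicity and injectivity
      -- place them at the translates of `y` and `x` by `(u - t) n`.
      exchange : ∀ w {x y} t → w ⟨ y ⟩ ≡ K t → w ⟨ x ⟩ ≡ 1+ (w ⟨ y ⟩) → Exchange w (s ∙ w) x y
      exchange w {x} {y} t wy≡ wx≡ = record
        { 1<n        = generator⇒1<n
        ; w-adjacent = wx≡
        ; v-adjacent = trans sy≡ (cong 1+_ (sym sx≡))
        ; w⇒v        = w⇒v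
        ; v⇒w        = v⇒w
        }
        where
        sy≡ : s ⟨ w ⟨ y ⟩ ⟩ ≡ 1+ K t
        sy≡ = trans (cong (s ⟨_⟩) wy≡) (raises′ t)
        sx≡ : s ⟨ w ⟨ x ⟩ ⟩ ≡ K t
        sx≡ = trans (cong (s ⟨_⟩) (trans wx≡ (cong 1+_ wy≡))) (lowers′ t)
        lemma : ∀ u t → u ≡ t + (u - t)
        lemma = solve-∀
        K-from : ∀ u → K u ≡ K t + (u - t) ℤ.* + n
        K-from u = trans (cong K (lemma u t)) (K-shift t (u - t))
        at-y : ∀ {p} u → w ⟨ p ⟩ ≡ K u → p ≡ y + (u - t) ℤ.* + n
        at-y {p} u eq = to-injective (bijection w) (trans eq (trans (K-from u)
          (trans (cong (_+ (u - t) ℤ.* + n) (sym wy≡)) (sym (shift-periodic′ w y (u - t))))))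
        at-x : ∀ {p} u → w ⟨ p ⟩ ≡ 1+ K u → p ≡ x + (u - t) ℤ.* + n
        at-x {p} u eq = to-injective (bijection w) (trans eq (trans (cong 1+_ (K-from u))
          (trans (sym (+-assoc (+ 1) (K t) _))
          (trans (cong (_+ (u - t) ℤ.* + n) (trans (cong 1+_ (sym wy≡)) (sym wx≡)))
                 (sym (shift-periodic′ w x (u - t)))))))
        w⇒v : ∀ p q → w ⟨ p ⟩ < w ⟨ q ⟩ → s ⟨ w ⟨ p ⟩ ⟩ < s ⟨ w ⟨ q ⟩ ⟩ ⊎
              ∃[ u ] p ≡ y + u ℤ.* + n × q ≡ x + u ℤ.* + n
        w⇒v p q lt with order-kept lt
        ... | inj₁ s<s = inj₁ s<s
        ... | inj₂ (u , wp≡ , wq≡) = inj₂ (u - t , at-y u wp≡ , at-x u wq≡)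
        v⇒w : ∀ p q → s ⟨ w ⟨ p ⟩ ⟩ < s ⟨ w ⟨ q ⟩ ⟩ → w ⟨ p ⟩ < w ⟨ q ⟩ ⊎
              ∃[ u ] p ≡ x + u ℤ.* + n × q ≡ y + u ℤ.* + n
        v⇒w p q lt with <-cmp (w ⟨ p ⟩) (w ⟨ q ⟩)
        ... | tri< w<w _ _ = inj₁ w<w
        ... | tri≈ _ w≡w _ = contradiction (cong (s ⟨_⟩) w≡w) (<⇒≢ lt)
        ... | tri> _ _ w>w with w⇒v q p w>w
        ...   | inj₁ s>s = contradiction s>s (<-asym lt)
        ...   | inj₂ (u , q≡ , p≡) = inj₂ (u , p≡ , q≡)

  module ConstructGenerator (1<n : 1 ℕ.< n) (k : Fin n) where
    open SimpleGenerator k using (K; K-shift; K?)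

    abstract

      indicator : ℤ → ℤ
      indicator a with K? a
      ... | inj₁ _ = + 1
      ... | inj₂ _ = + 0

      indicator-K : ∀ {a} t → a ≡ K t → indicator a ≡ + 1
      indicator-K {a} t a≡K with K? a
      ... | inj₁ _   = refl
      ... | inj₂ a≢K = contradiction a≡K (a≢K t)

      indicator-other : ∀ {a} → (∀ t → a ≢ K t) → indicator a ≡ + 0
      indicator-other {a} a≢K with K? a
      ... | inj₁ (t , a≡K) = contradiction a≡K (a≢K t)
      ... | inj₂ _         = refl

      indicator-invariant : Invariant n indicator
      indicator-invariant a with K? a
      ... | inj₁ (t , refl) = indicator-K (t + + 1) (trans (lemma (K t) (+ n)) (sym (K-shift t (+ 1))))
        where
        lemma : ∀ x n → x + n ≡ x + + 1 ℤ.* n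
        lemma = solve-∀
      ... | inj₂ a≢K = indicator-other λ t eq → a≢K (t - + 1)
        (trans (lemma₁ a (+ n)) (trans (cong (_- + n) eq) (lemma₂ (window k) t (+ n))))
        where
        lemma₁ : ∀ x n → x ≡ x + n - n
        lemma₁ = solve-∀
        lemma₂ : ∀ x t n → x + t ℤ.* n - n ≡ x + (t - + 1) ℤ.* n
        lemma₂ = solve-∀

    K≢1+K : ∀ t u → K t ≢ 1+ K u
    K≢1+K t u eq = <⇒≱ (+<+ 1<n) (n≤1 (t - u) (trans (lemma₁ (window k) t u (+ n))
      (trans (cong (_- K u) eq) (lemma₂ (K u)))))
      where
      lemma₁ : ∀ k t u n → (t - u) ℤ.* n ≡ k + t ℤ.* n - (k + u ℤ.* n)
      lemma₁ = solve-∀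
      lemma₂ : ∀ x → + 1 + x - x ≡ + 1
      lemma₂ = solve-∀
      n≤1 : ∀ d → d ℤ.* + n ≡ + 1 → + n ≤ + 1
      n≤1 d dn≡1 = begin
        + n            ≡⟨ sym (*-identityˡ (+ n)) ⟩
        + 1 ℤ.* + n    ≤⟨ *-monoʳ-≤-nonNeg (+ n) {+ 1} {d} (<⇒1+≤ 0<d) ⟩
        d ℤ.* + n      ≡⟨ dn≡1 ⟩
        + 1            ∎
        where
        open ≤-Reasoning
        0<d : + 0 < d
        0<d = *-cancelʳ-<-nonNeg {+ 0} {d} (+ n)
          (subst₂ _<_ (sym (*-zeroˡ (+ n))) (sym dn≡1) (+<+ (ℕ.s≤s ℕ.z≤n)))

    -- One formula for all three kinds of integers: the first indicator raises the class of `K`, the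
    -- second lowers the successors of its elements. Over a window both indicators have the same
    -- sum, so the sum of values stays that of the identity.
    swap : ℤ → ℤ
    swap a = a + indicator a - indicator (a - + 1)

    pred-K : ∀ a t → a - + 1 ≡ K t → a ≡ 1+ K t
    pred-K a t eq = trans (lemma a) (cong 1+_ eq)
      where
      lemma : ∀ a → a ≡ + 1 + (a - + 1)
      lemma = solve-∀

    swap-K : ∀ t → swap (K t) ≡ 1+ K t
    swap-K t = trans
      (cong₂ (λ x y → K t + x - y) (indicator-K t refl)
        (indicator-other λ u eq → K≢1+K t u (pred-K (K t) u eq)))
      (lemma (K t))
      where
      lemma : ∀ x → x + + 1 - + 0 ≡ + 1 + x
      lemma = solve-∀

    swap-1+K : ∀ t → swap (1+ K t) ≡ K t
    swap-1+K t = trans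
      (cong₂ (λ x y → 1+ K t + x - y) (indicator-other λ u eq → K≢1+K u t (sym eq))
        (indicator-K t (lemma₁ (K t))))
      (lemma₂ (K t))
      where
      lemma₁ : ∀ x → + 1 + x - + 1 ≡ x
      lemma₁ = solve-∀
      lemma₂ : ∀ x → + 1 + x + + 0 - + 1 ≡ x
      lemma₂ = solve-∀

    swap-other : ∀ a → (∀ t → a ≢ K t) → (∀ t → a ≢ 1+ K t) → swap a ≡ a
    swap-other a a≢K a≢1+K = trans
      (cong₂ (λ x y → a + x - y) (indicator-other a≢K) (indicator-other λ t eq → a≢1+K t (pred-K a t eq)))
      (lemma a)
      where
      lemma : ∀ x → x + + 0 - + 0 ≡ x
      lemma = solve-∀

    swap-involutive : ∀ a → swap (swap a) ≡ a
    swap-involutive a = cases (K? a) (K? (a - + 1))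
      where
      cases : (∃[ t ] a ≡ K t) ⊎ (∀ t → a ≢ K t) →
              (∃[ t ] a - + 1 ≡ K t) ⊎ (∀ t → a - + 1 ≢ K t) → swap (swap a) ≡ a
      cases (inj₁ (t , refl)) _ = trans (cong swap (swap-K t)) (swap-1+K t)
      cases (inj₂ _) (inj₁ (t , a-1≡)) with refl ← pred-K a t a-1≡ =
        trans (cong swap (swap-1+K t)) (swap-K t)
      cases (inj₂ a≢K) (inj₂ a-1≢K) = trans (cong swap fix) fix
        where
        lemma : ∀ x → + 1 + x - + 1 ≡ x
        lemma = solve-∀
        fix = swap-other a a≢K λ t eq → a-1≢K t (trans (cong (_- + 1) eq) (lemma (K t)))

    generator : AffinePermutation n
    generator = record
      { bijection  = mk↔ₛ′ swap swap swap-involutive swap-involutive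
      ; periodic   = λ i → trans
          (cong₂ (λ x y → i + + n + x - y) (indicator-invariant i)
            (trans (cong indicator (+-shuffle i (+ n) -[1+ 0 ])) (indicator-invariant (i - + 1))))
          (lemma i (+ n) (indicator i) (indicator (i - + 1)))
      ; normalised = trans (+-cancelʳ I (trans
          (trans (cong (λ x → ∑[ j < n ] swap (window j) + x)
                       (sym (Residues.sum-reindex m (translation -[1+ 0 ])
                              (λ i → +-shuffle i (+ n) -[1+ 0 ]) indicator indicator-invariant)))
          (trans (sym (∑-distrib-+ {n} (swap ∘ window) (λ j → indicator (window j - + 1))))
                 (sum-cong-≗ {n} λ j → lemma′ (window j + indicator (window j)) (indicator (window j - + 1)))))
          (∑-distrib-+ {n} window (indicator ∘ window)))) (∑-window n)
      }
      where
      I = ∑[ j < n ] indicator (window j)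
      lemma : ∀ i n x y → i + n + x - y ≡ i + x - y + n
      lemma = solve-∀
      lemma′ : ∀ x y → x - y + y ≡ x
      lemma′ = solve-∀

    isGenerator : IsSimpleGenerator k generator
    isGenerator = record
      { raises = λ t → trans (swap-K t) (+-comm (+ 1) (K t))
      ; lowers = λ t → trans (cong swap (+-comm (K t) (+ 1))) (swap-1+K t)
      ; fixes  = λ j j≢K j≢K+1 → swap-other j j≢K λ t eq → j≢K+1 t (trans eq (+-comm (+ 1) (K t)))
      }

  module _ {k : Fin n} {s : AffinePermutation n} (gen : IsSimpleGenerator k s) (w : AffinePermutation n) where
    open SimpleGenerator k

    private
      x y : ℤ
      x = w ⁻¹ ⟨ 1+ K (+ 0) ⟩
      y = w ⁻¹ ⟨ K (+ 0) ⟩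

      exch : Exchange w (s ∙ w) x y
      exch = exchange gen w (+ 0) (strictlyInverseˡ (bijection w) _)
        (trans (strictlyInverseˡ (bijection w) _) (cong 1+_ (sym (strictlyInverseˡ (bijection w) _))))

    len-descent : w ⁻¹ ⟨ 1+ K (+ 0) ⟩ < w ⁻¹ ⟨ K (+ 0) ⟩ → len w ≡ suc (len (s ∙ w))
    len-descent = len-exchange exch

    len-simple : len (s ∙ w) ℕ.≤ suc (len w)
    len-simple with <-cmp x y
    ... | tri< x<y _ _ = ℕ.≤-trans (ℕ.n≤1+n _) (ℕ.≤-trans (ℕ.≤-reflexive (sym (len-descent x<y))) (ℕ.n≤1+n _))
    ... | tri≈ _ x≡y _ = contradiction (sym (to-injective (bijection (w ⁻¹)) x≡y)) (<⇒≢ (<1+ (K (+ 0))))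
    ... | tri> _ _ y<x = ℕ.≤-reflexive (len-exchange (exchange-sym exch) y<x)

  -- Word length compared with the inversion count.

  len≤word : ∀ ss w → IsWordFor w ss → len w ℕ.≤ length ss
  len≤word []       w (_ , ε≈w) = ℕ.≤-reflexive (trans (len-cong w ε (λ i → sym (ε≈w i))) len-ε)
  len≤word (s ∷ ss) w ((_ , gen) ∷ simple , sv≈w) = ℕ.≤-trans
    (ℕ.≤-reflexive (len-cong w (s ∙ v) λ i → sym (sv≈w i)))
    (ℕ.≤-trans (len-simple gen v) (ℕ.s≤s (len≤word ss v (simple , λ _ → refl))))
    where
    v = foldr _∙_ ε ss

  no-descents⇒≈ε : ∀ w → (∀ (k : Fin n) → ¬ (w ⁻¹ ⟨ 1+ window k ⟩ < w ⁻¹ ⟨ window k ⟩)) → w ≈ ε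
  no-descents⇒≈ε w ¬desc i = trans (cong (w ⟨_⟩) (sym (increasing⇒≈ε (w ⁻¹) increasing i)))
                                  (strictlyInverseˡ (bijection w) i)
    where
    u = w ⁻¹
    at-window : ∀ (k : Fin n) → u ⟨ window k ⟩ < u ⟨ 1+ window k ⟩
    at-window k = ≤∧≢⇒< (≮⇒≥ (¬desc k)) λ eq → <⇒≢ (<1+ (window k)) (to-injective (bijection u) eq)
    increasing : ∀ i → u ⟨ i ⟩ < u ⟨ 1+ i ⟩
    increasing i with k , q , refl ← residue i = subst₂ _<_
      (sym (shift-periodic′ u (window k) q))
      (sym (trans (cong (u ⟨_⟩) (sym (+-assoc (+ 1) (window k) (q ℤ.* + n)))) (shift-periodic′ u (1+ window k) q)))
      (+-monoˡ-< (q ℤ.* + n) (at-window k))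

  Descent : AffinePermutation n → Set
  Descent w = ∃ λ (k : Fin n) → w ⁻¹ ⟨ 1+ window k ⟩ < w ⁻¹ ⟨ window k ⟩

  descent? : ∀ w → Dec (Descent w)
  descent? w = any? (λ k → w ⁻¹ ⟨ 1+ window k ⟩ <? w ⁻¹ ⟨ window k ⟩)

  descend : ∀ (w : AffinePermutation n) → Descent w →
            ∃[ k ] ∃[ s ] IsSimpleGenerator k s × len w ≡ suc (len (s ∙ w))
  descend w (k , desc) = k , generator , isGenerator , len-descent isGenerator w
    (subst (λ a → w ⁻¹ ⟨ 1+ a ⟩ < w ⁻¹ ⟨ a ⟩) (sym (+-identityʳ (window k))) desc)
    where
    1<n : 1 ℕ.< n
    1<n = descent⇒1<n (w ⁻¹) (window k) desc
    open ConstructGenerator 1<n k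

  reduced-word : ∀ ℓ w → len w ≡ ℓ → ∃[ ss ] IsWordFor w ss × length ss ≡ ℓ
  reduced-word ℓ w len≡ = build ℓ w len≡ (descent? w)
    where
    build : ∀ ℓ w → len w ≡ ℓ → Dec (Descent w) → ∃[ ss ] IsWordFor w ss × length ss ≡ ℓ
    build ℓ w len≡ (no ¬desc) =
      [] , ([] , λ i → sym (w≈ε i)) , trans (sym len-ε) (trans (len-cong ε w λ i → sym (w≈ε i)) len≡)
      where
      w≈ε : w ≈ ε
      w≈ε = no-descents⇒≈ε w λ k desc → ¬desc (k , desc)
    build zero w len≡ (yes desc) =
      contradiction (trans (sym (proj₂ (proj₂ (proj₂ (descend w desc))))) len≡) λ ()
    build (suc ℓ) w len≡ (yes desc) =
      let k , s , gen , len-w = descend w desc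
          ss , (simple , ss≈) , length≡ =
            build ℓ (s ∙ w) (ℕ.suc-injective (trans (sym len-w) len≡)) (descent? (s ∙ w))
      in s ∷ ss ,
         ((k , gen) ∷ simple ,
          λ i → trans (cong (s ⟨_⟩) (ss≈ i)) (SimpleGenerator.involutive k gen (w ⟨ i ⟩))) ,
         cong suc length≡

  hasLength : ∀ w → HasLength w (len w)
  hasLength w = reduced-word (len w) w refl , λ ss → len≤word ss w

  hasLength-unique : ∀ w {ℓ} → HasLength w ℓ → ℓ ≡ len w
  hasLength-unique w {ℓ} ((ss , word , length≡) , shortest)
    with ss′ , word′ , length′≡ ← reduced-word (len w) w refl = ℕ.≤-antisym
    (ℕ.≤-trans (shortest ss′ word′) (ℕ.≤-reflexive length′≡))
    (ℕ.≤-trans (len≤word ss w word) (ℕ.≤-reflexive length≡))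

  -- The sylvester classes

  shifted : ∀ (w : AffinePermutation n) {x y} t → w ⟨ x ⟩ < w ⟨ y ⟩ →
            w ⟨ x + t ℤ.* + n ⟩ < w ⟨ y + t ℤ.* + n ⟩
  shifted w {x} {y} t lt = subst₂ _<_ (sym (shift-periodic′ w x t)) (sym (shift-periodic′ w y t))
    (+-monoˡ-< (t ℤ.* + n) lt)

  infix 4 _between_,_

  _between_,_ : ℤ → ℤ → ℤ → Set
  k between i , j = i ⊓ j < k × k < i ⊔ j

  between-swap : ∀ {k} i j → k between i , j → k between j , i
  between-swap {k} i j (lo , hi) = subst (_< k) (⊓-comm i j) lo , subst (k <_) (⊔-comm i j) hi

  between-shift : ∀ {k} i j c → k between i , j → k + c between i + c , j + c
  between-shift {k} i j c (lo , hi) =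
    subst (_< k + c) (mono-≤-distrib-⊓ (+-monoˡ-≤ c) i j) (+-monoˡ-< c lo) ,
    subst (k + c <_) (mono-≤-distrib-⊔ (+-monoˡ-≤ c) i j) (+-monoˡ-< c hi)

  between-trans : ∀ {k l} i j → k between i , j → l between i , k → l between i , j
  between-trans {k} {l} i j (lo , hi) (lo′ , hi′) =
    ≤-<-trans (⊓-glb (i⊓j≤i i j) (<⇒≤ lo)) lo′ , <-≤-trans hi′ (⊔-lub (i≤i⊔j i j) (<⇒≤ hi))

  incomparable-swap : ∀ (w : AffinePermutation n) i j → Incomparable w i j → Incomparable w j i
  incomparable-swap w i j (k , lo , hi , above) =
    let lo′ , hi′ = between-swap i j (lo , hi)
    in k , lo′ , hi′ , subst (_< w ⟨ k ⟩) (⊔-comm (w ⟨ i ⟩) (w ⟨ j ⟩)) above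

  ⊔-lub-< : ∀ {i j k} → i < k → j < k → i ⊔ j < k
  ⊔-lub-< {i} {j} {k} i<k j<k with ⊔-sel i j
  ... | inj₁ eq = subst (_< k) (sym eq) i<k
  ... | inj₂ eq = subst (_< k) (sym eq) j<k

  module _ {w v : AffinePermutation n} {x y} (ex : Exchange w v x y)
           (z : ℤ) (z-between : z between x , y)
           (wx<wz : w ⟨ x ⟩ < w ⟨ z ⟩) (vx<vz : v ⟨ x ⟩ < v ⟨ z ⟩) (vy<vz : v ⟨ y ⟩ < v ⟨ z ⟩) where
    open Exchange ex

    -- When the exchanged pair hides behind r, the translate of z takes over the role of r.
    incomparable-hidden : ∀ p q {r} → r between p , q → ∀ t → p ≡ y + t ℤ.* + n → r ≡ x + t ℤ.* + n →
                          w ⟨ q ⟩ < w ⟨ r ⟩ → Incomparable v p q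
    incomparable-hidden p q {r} r-between t refl refl wq<wr =
      let lo , hi = between-trans p q r-between
                      (between-swap r p (between-shift x y (t ℤ.* + n) z-between))
      in z′ , lo , hi , ⊔-lub-< (shifted v t vy<vz) vq<vz′
      where
      z′ = z + t ℤ.* + n
      vq<vz′ : v ⟨ q ⟩ < v ⟨ z′ ⟩
      vq<vz′ with w⇒v q r wq<wr
      ... | inj₁ vq<vr = <-trans vq<vr (shifted v t vx<vz)
      -- Both pairs are exchanged translates sharing `r`, so `q` is the same translate of `y` as
      -- `p`.
      ... | inj₂ (t′ , q≡ , r≡) = subst (λ q → v ⟨ q ⟩ < v ⟨ z′ ⟩) (sym (trans q≡ (cong (λ c → y + c) t′n≡tn)))
                                        (shifted v t vy<vz)
        where
        lemma : ∀ x c → x + c - x ≡ c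
        lemma = solve-∀
        t′n≡tn : t′ ℤ.* + n ≡ t ℤ.* + n
        t′n≡tn = trans (sym (lemma x (t′ ℤ.* + n))) (trans (cong (_- x) (sym r≡)) (lemma x (t ℤ.* + n)))

    incomparable-exchange : ∀ p q → Incomparable w p q → Incomparable v p q
    incomparable-exchange p q (r , lo , hi , above)
      with wp<wr ← ≤-<-trans (i≤i⊔j (w ⟨ p ⟩) (w ⟨ q ⟩)) above
         | wq<wr ← ≤-<-trans (i≤j⊔i (w ⟨ p ⟩) (w ⟨ q ⟩)) above
      with w⇒v p r wp<wr | w⇒v q r wq<wr
    ... | inj₁ vp<vr | inj₁ vq<vr = r , lo , hi , ⊔-lub-< vp<vr vq<vr
    ... | inj₂ (t , p≡ , r≡) | _  = incomparable-hidden p q (lo , hi) t p≡ r≡ wq<wr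
    ... | inj₁ _ | inj₂ (t , q≡ , r≡) =
      incomparable-swap v q p (incomparable-hidden q p (between-swap p q (lo , hi)) t q≡ r≡ wp<wr)

    incomparable-translate : w ⟨ y ⟩ < w ⟨ z ⟩ → ∀ t → Incomparable w (x + t ℤ.* + n) (y + t ℤ.* + n)
    incomparable-translate wy<wz t =
      let lo , hi = between-shift x y (t ℤ.* + n) z-between
      in z + t ℤ.* + n , lo , hi , ⊔-lub-< (shifted w t wx<wz) (shifted w t wy<wz)

    -- Only translates of `(y, x)` change their order of values, and `z` makes these incomparable in
    -- `w`, so a comparable pair is never one of them.
    ≼-exchange : w ⟨ y ⟩ < w ⟨ z ⟩ → (∀ p q → Incomparable v p q → Incomparable w p q) →
                 ∀ p q → w ⊢ p ≼ q → v ⊢ p ≼ q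
    ≼-exchange wy<wz v⊆w p q (comparable , wp≤wq) = (λ inc → comparable (v⊆w p q inc)) , vp≤vq
      where
      vp≤vq : v ⟨ p ⟩ ≤ v ⟨ q ⟩
      vp≤vq with w ⟨ p ⟩ ≟ w ⟨ q ⟩
      ... | yes eq = ≤-reflexive (cong (v ⟨_⟩) (to-injective (bijection w) eq))
      ... | no neq with w⇒v p q (≤∧≢⇒< wp≤wq neq)
      ...   | inj₁ lt = <⇒≤ lt
      ...   | inj₂ (t , refl , refl) =
        contradiction (incomparable-swap w _ _ (incomparable-translate wy<wz t)) comparable

  -- The one comparison with `z` yields the other three: `w y` and `v x` lie just below `w x` and
  -- `v y`, and `(y, z)` is not an exchanged pair because `z` differs from `x`.
  exchange-≡syl : ∀ {w v x y} → Exchange w v x y → ∀ z → z between x , y → w ⟨ x ⟩ < w ⟨ z ⟩ → v ≡syl w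
  exchange-≡syl {w} {v} {x} {y} ex z z-between wx<wz p q =
    mk⇔ (≼-exchange ex′ z z-between′ vy<vz wy<wz wx<wz vx<vz w⊆v p q)
        (≼-exchange ex z z-between wx<wz vx<vz vy<vz wy<wz v⊆w p q)
    where
    open Exchange ex
    ex′ = exchange-sym ex
    z-between′ = between-swap x y z-between
    wy<wz : w ⟨ y ⟩ < w ⟨ z ⟩
    wy<wz = <-trans (subst (w ⟨ y ⟩ <_) (sym w-adjacent) (<1+ _)) wx<wz
    vy<vz : v ⟨ y ⟩ < v ⟨ z ⟩
    vy<vz with w⇒v y z wy<wz
    ... | inj₁ lt = lt
    ... | inj₂ (t , y≡ , z≡) = contradiction (cong (w ⟨_⟩) (sym z≡x)) (<⇒≢ wx<wz)
      where
      lemma : ∀ y c → c ≡ y + c - y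
      lemma = solve-∀
      z≡x : z ≡ x
      z≡x = trans z≡ (trans
        (cong (λ c → x + c) (trans (lemma y (t ℤ.* + n)) (trans (cong (_- y) (sym y≡)) (+-inverseʳ y))))
        (+-identityʳ x))
    vx<vz : v ⟨ x ⟩ < v ⟨ z ⟩
    vx<vz = <-trans (subst (v ⟨ x ⟩ <_) (sym v-adjacent) (<1+ _)) vy<vz
    w⊆v = incomparable-exchange ex z z-between wx<wz vx<vz vy<vz
    v⊆w = incomparable-exchange ex′ z z-between′ vy<vz wy<wz wx<wz

  -- Induction on the gap `d`. The position `p` of the value `w k + 1` either precedes `j`, and then
  -- replaces `i` with adjacent values, or follows `j`, and then replaces `k` with a gap smaller by
  -- one.
  adjacent-231 : ∀ (w : AffinePermutation n) d {i j k} → i < j → j < k → w ⟨ i ⟩ ≡ 1+ (w ⟨ k ⟩ + + d) →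
                 w ⟨ i ⟩ < w ⟨ j ⟩ → ∃[ i ] ∃[ j ] ∃[ k ] i < j × j < k × w ⟨ i ⟩ ≡ 1+ (w ⟨ k ⟩) × w ⟨ i ⟩ < w ⟨ j ⟩
  adjacent-231 w zero {i} {j} {k} i<j j<k wi≡ wi<wj =
    i , j , k , i<j , j<k , trans wi≡ (cong 1+_ (+-identityʳ (w ⟨ k ⟩))) , wi<wj
  adjacent-231 w (suc d) {i} {j} {k} i<j j<k wi≡ wi<wj = locate (<-cmp p j)
    where
    p = w ⁻¹ ⟨ 1+ (w ⟨ k ⟩) ⟩
    wp≡ : w ⟨ p ⟩ ≡ 1+ (w ⟨ k ⟩)
    wp≡ = strictlyInverseˡ (bijection w) _
    wi≡′ : w ⟨ i ⟩ ≡ 1+ (w ⟨ p ⟩ + + d)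
    wi≡′ = trans wi≡ (cong 1+_ (trans (1++ (w ⟨ k ⟩) d) (cong (_+ + d) (sym wp≡))))
    wp<wj : w ⟨ p ⟩ < w ⟨ j ⟩
    wp<wj = ≤-<-trans
      (≤-trans (i≤i+j (w ⟨ p ⟩) (+ suc d)) (≤-reflexive (trans (+1+ (w ⟨ p ⟩) d) (sym wi≡′)))) wi<wj
    locate : _ → _
    locate (tri< p<j _ _) = p , j , k , p<j , j<k , wp≡ , wp<wj
    locate (tri≈ _ p≡j _) = contradiction (cong (w ⟨_⟩) p≡j) (<⇒≢ wp<wj)
    locate (tri> _ _ j<p) = adjacent-231 w d i<j j<p wi≡′ wi<wj

  minimal⇒avoids231 : ∀ u w → IsMinimalInClass u w → Avoids231 w
  minimal⇒avoids231 u w (w≡u , minimal) (i , j , k , i<j , j<k , wk<wi , wi<wj)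
    with d , wi≡ ← <⇒offset wk<wi
    with i , j , k , i<j , j<k , wi≡ , wi<wj ← adjacent-231 w d i<j j<k wi≡ wi<wj = ℕ.1+n≢n (begin
      suc (len v)  ≡⟨ sym len-w ⟩
      len w        ≡⟨ len-cong w v (λ i → sym (minimal v v≡u v≤w i)) ⟩
      len v        ∎)
    where
    open ≡-Reasoning
    i<k = <-trans i<j j<k
    κ : Fin n
    κ = res (w ⟨ k ⟩)
    at-k : ∃[ t ] w ⟨ k ⟩ ≡ window κ + t ℤ.* + n
    at-k = proj₂ (residue (w ⟨ k ⟩))
    1<n : 1 ℕ.< n
    1<n = descent⇒1<n (w ⁻¹) (w ⟨ k ⟩) (subst₂ _<_
      (trans (sym (strictlyInverseʳ (bijection w) i)) (cong (w ⁻¹ ⟨_⟩) wi≡))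
      (sym (strictlyInverseʳ (bijection w) k)) i<k)
    open ConstructGenerator 1<n κ
    open SimpleGenerator κ
    s v : AffinePermutation n
    s = generator
    v = s ∙ w
    exch : Exchange w v i k
    exch = exchange isGenerator w (proj₁ at-k) (proj₂ at-k) wi≡
    len-w : len w ≡ suc (len v)
    len-w = len-exchange exch i<k
    v≡w : v ≡syl w
    v≡w = exchange-≡syl exch j (≤-<-trans (i⊓j≤i i k) i<j , <-≤-trans j<k (i≤j⊔i i k)) wi<wj
    v≡u : v ≡syl u
    v≡u p q = mk⇔ (Equivalence.to (w≡u p q) ∘ Equivalence.to (v≡w p q))
                  (Equivalence.from (v≡w p q) ∘ Equivalence.from (w≡u p q))
    -- An empty word would give `w ≈ v`, contradicting their lengths; so the one-letter word `s` is
    -- shortest.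
    nonempty : ∀ ss → IsWordFor (w ∙ v ⁻¹) ss → 1 ℕ.≤ length ss
    nonempty (_ ∷ _) _ = ℕ.s≤s ℕ.z≤n
    nonempty [] (_ , ε≈wv⁻¹) = contradiction
      (trans (sym len-w) (len-cong w v λ i → sym
        (trans (ε≈wv⁻¹ (v ⟨ i ⟩)) (cong (w ⟨_⟩) (strictlyInverseʳ (bijection v) i)))))
      ℕ.1+n≢n
    v≤w : v ≤L w
    v≤w = len v , len w , 1 , hasLength v , hasLength w ,
      ((s ∷ [] , ((κ , isGenerator) ∷ [] , s≈wv⁻¹) , refl) , nonempty) ,
      trans (lemma (+ len v)) (cong (λ l → + l - + len v) (sym len-w))
      where
      s≈wv⁻¹ : s ≈ w ∙ v ⁻¹
      s≈wv⁻¹ i = trans (cong (s ⟨_⟩) (sym (strictlyInverseˡ (bijection s) i)))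
        (trans (involutive isGenerator _) (sym (strictlyInverseˡ (bijection w) _)))
      lemma : ∀ l → + 1 ≡ + 1 + l - l
      lemma = solve-∀

  syl⇒⊆Inv : ∀ v w → Avoids231 w → v ≡syl w → w ⊆Inv v
  syl⇒⊆Inv v w avoids v≡w {i} {j} i<j wj<wi = ≤∧≢⇒<
    (proj₂ (Equivalence.from (v≡w j i) (comparable , <⇒≤ wj<wi)))
    λ eq → <⇒≢ i<j (sym (to-injective (bijection v) eq))
    where
    comparable : ¬ Incomparable w j i
    comparable (k , lo , hi , above) = avoids (i , k , j ,
      subst (_< k) (i≥j⇒i⊓j≡j (<⇒≤ i<j)) lo , subst (k <_) (i≥j⇒i⊔j≡i (<⇒≤ i<j)) hi , wj<wi ,
      ≤-<-trans (i≤j⊔i (w ⟨ j ⟩) (w ⟨ i ⟩)) above)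

  ≡syl-sym : ∀ (v w : AffinePermutation n) → v ≡syl w → w ≡syl v
  ≡syl-sym v w v≡w i j = mk⇔ (Equivalence.from (v≡w i j)) (Equivalence.to (v≡w i j))

  ≡syl-refl : ∀ (w : AffinePermutation n) → w ≡syl w
  ≡syl-refl w i j = mk⇔ (λ x → x) (λ x → x)

  -- An element `v` of the class has at least the length of `w`. If also `v ≤L w`, the length of
  -- `w v⁻¹` is at most zero, so its word is empty and `v ≈ w`.
  avoids231⇒minimal : ∀ w → Avoids231 w → IsMinimalInClass w w
  avoids231⇒minimal w avoids = ≡syl-refl w , λ v v≡w v≤w → below v (syl⇒⊆Inv v w avoids v≡w) v≤w
    where
    below : ∀ v → w ⊆Inv v → v ≤L w → v ≈ w
    below v w⊆v (ℓv , ℓw , ℓ , hv , hw , ((ss , (_ , ss≈) , length≡) , _) , ℓ≡) = go ss length≡0 ss≈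
      where
      ℓ≤0 : + ℓ ≤ + 0
      ℓ≤0 = ≤-trans (≤-reflexive ℓ≡) (i≤j⇒i-j≤0 (+≤+
        (subst₂ ℕ._≤_ (sym (hasLength-unique w hw)) (sym (hasLength-unique v hv)) (len-mono w v w⊆v))))
      length≡0 : length ss ≡ 0
      length≡0 = trans length≡ (ℕ.n≤0⇒n≡0 (drop‿+≤+ ℓ≤0))
      go : ∀ ss → length ss ≡ 0 → foldr _∙_ ε ss ≈ w ∙ v ⁻¹ → v ≈ w
      go [] _ ε≈ i = trans (ε≈ (v ⟨ i ⟩)) (cong (w ⟨_⟩) (strictlyInverseʳ (bijection v) i))

  sortable⇔avoids231 : ∀ w → OneStackSortable w ⇔ Avoids231 w
  sortable⇔avoids231 w = mk⇔ forth back
    where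
    forth : OneStackSortable w → Avoids231 w
    forth (u , (minimal , _) , ε≈wu⁻¹) (i , j , k , i<j , j<k , wk<wi , wi<wj) =
      minimal⇒avoids231 w u minimal (i , j , k , i<j , j<k ,
        subst₂ _<_ (w≈u k) (w≈u i) wk<wi , subst₂ _<_ (w≈u i) (w≈u j) wi<wj)
      where
      w≈u : w ≈ u
      w≈u i = trans (cong (w ⟨_⟩) (sym (strictlyInverseʳ (bijection u) i))) (sym (ε≈wu⁻¹ (u ⟨ i ⟩)))
    back : Avoids231 w → OneStackSortable w
    back avoids = w , (avoids231⇒minimal w avoids , unique) , λ i → sym (strictlyInverseˡ (bijection w) i)
      where
      unique : ∀ u → IsMinimalInClass w u → u ≈ w
      unique u minimal = inversions-determine u w
        (syl⇒⊆Inv w u (minimal⇒avoids231 w u minimal) (≡syl-sym u w (proj₁ minimal)))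
        (syl⇒⊆Inv u w avoids (proj₁ minimal))

  -- Constructing affine permutations

  -- A missed value `y` could be punched out, giving an injection into a set with one element fewer.
  injective⇒surjective : ∀ (f : Fin n → Fin n) → (∀ {i j} → f i ≡ f j → i ≡ j) → ∀ y → ∃[ x ] f x ≡ y
  injective⇒surjective f injective y with any? (λ x → f x Fin.≟ y)
  ... | yes found = found
  ... | no ¬found = contradiction
    (Fin.injective⇒≤ {f = λ x → Fin.punchOut {i = y} {j = f x} λ eq → ¬found (x , sym eq)}
      λ {i} {j} eq → injective (Fin.punchOut-injective {i = y} {j = f i} {k = f j} _ _ eq))
    ℕ.1+n≰n

  module _ (f : ℤ → ℤ) (per : Periodic n f) (injective : ∀ {i j} → f i ≡ f j → i ≡ j) where

    private
      ρ : Fin n → Fin n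
      ρ k = res (f (window k))

      q : Fin n → ℤ
      q k = proj₁ (proj₂ (residue (f (window k))))

      f-window : ∀ k → f (window k) ≡ window (ρ k) + q k ℤ.* + n
      f-window k = proj₂ (proj₂ (residue (f (window k))))

      ρ-injective : ∀ {i j} → ρ i ≡ ρ j → i ≡ j
      ρ-injective {i} {j} eq = window-unique i j (q i - q j) (injective (begin
        f (window i)                                     ≡⟨ f-window i ⟩
        window (ρ i) + q i ℤ.* + n                       ≡⟨ cong (λ k → window k + q i ℤ.* + n) eq ⟩
        window (ρ j) + q i ℤ.* + n                       ≡⟨ lemma (window (ρ j)) (q i) (q j) (+ n) ⟩
        window (ρ j) + q j ℤ.* + n + (q i - q j) ℤ.* + n ≡⟨ cong (_+ (q i - q j) ℤ.* + n) (sym (f-window j)) ⟩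
        f (window j) + (q i - q j) ℤ.* + n               ≡⟨ sym (shift-periodic {n} {f} per (window j) (q i - q j)) ⟩
        f (window j + (q i - q j) ℤ.* + n)               ∎))
        where
        open ≡-Reasoning
        lemma : ∀ w a b n → w + a ℤ.* n ≡ w + b ℤ.* n + (a - b) ℤ.* n
        lemma = solve-∀

    -- If two window entries had images of equal residue, injectivity of `f` would identify them up
    -- to a multiple of `n`, hence outright. So `f` permutes the residues, and `a` is reached after
    -- a translation by a multiple of `n`.
    periodic-surjective : ∀ a → ∃[ i ] f i ≡ a
    periodic-surjective a = locate (residue a)
      where
      locate : (∃[ c ] ∃[ t ] a ≡ window c + t ℤ.* + n) → ∃[ i ] f i ≡ a
      locate (c , t , a≡) = hit (injective⇒surjective ρ ρ-injective c)
        where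
        hit : (∃[ k ] ρ k ≡ c) → ∃[ i ] f i ≡ a
        hit (k , ρk≡c) = window k + (t - q k) ℤ.* + n , (begin
          f (window k + (t - q k) ℤ.* + n)                  ≡⟨ shift-periodic {n} {f} per (window k) (t - q k) ⟩
          f (window k) + (t - q k) ℤ.* + n                  ≡⟨ cong (_+ (t - q k) ℤ.* + n) (f-window k) ⟩
          window (ρ k) + q k ℤ.* + n + (t - q k) ℤ.* + n    ≡⟨ lemma (window (ρ k)) (q k) t (+ n) ⟩
          window (ρ k) + t ℤ.* + n                          ≡⟨ cong (λ c → window c + t ℤ.* + n) ρk≡c ⟩
          window c + t ℤ.* + n                              ≡⟨ sym a≡ ⟩
          a                                                 ∎)
          where
          open ≡-Reasoning
          lemma : ∀ w q t n → w + q ℤ.* n + (t - q) ℤ.* n ≡ w + t ℤ.* n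
          lemma = solve-∀

    periodic-bijection : ℤ ↔ ℤ
    periodic-bijection = mk↔ₛ′ f (proj₁ ∘ periodic-surjective) (proj₂ ∘ periodic-surjective)
      λ i → injective (proj₂ (periodic-surjective (f i)))

  ∑-*ʳ : ∀ {k} (f : Fin k → ℤ) c → ∑[ i < k ] (f i ℤ.* c) ≡ (∑[ i < k ] f i) ℤ.* c
  ∑-*ʳ {zero}  f c = sym (*-zeroˡ c)
  ∑-*ʳ {suc k} f c = trans (cong (λ x → f Fin.zero ℤ.* c + x) (∑-*ʳ (f ∘ Fin.suc) c))
                           (sym (*-distribʳ-+ c (f Fin.zero) (∑[ i < k ] f (Fin.suc i))))

  module _ (p : ℤ ↔ ℤ) (per : Periodic n (to p)) where

    private
      q : Fin n → ℤ
      q k = proj₁ (proj₂ (residue (to p (window k))))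

    -- The images of the window permute the residues, so their sum exceeds that of the window by `n`
    -- times the sum of the quotients `q k`. Spread over `n` entries, this excess is an integral
    -- shift.
    offset : ℤ
    offset = - ∑[ k < n ] q k

    normalise : AffinePermutation n
    normalise = record
      { bijection  = translation offset ↔-∘ p
      ; periodic   = λ i → trans (cong (_+ offset) (per i)) (+-shuffle (to p i) (+ n) offset)
      ; normalised = begin
          ∑[ k < n ] (to p (window k) + offset)
            ≡⟨ ∑-distrib-+ {n} (to p ∘ window) (λ _ → offset) ⟩
          ∑[ k < n ] to p (window k) + ∑[ _ < n ] offset
            ≡⟨ cong₂ _+_ (trans (sum-cong-≗ {n} λ k → proj₂ (proj₂ (residue (to p (window k)))))
                                (∑-distrib-+ {n} (window ∘ res ∘ to p ∘ window) (λ k → q k ℤ.* + n)))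
                         (∑-const n offset) ⟩
          ∑[ k < n ] window (res (to p (window k))) + ∑[ k < n ] (q k ℤ.* + n) + + n ℤ.* offset
            ≡⟨ cong₂ (λ x y → x + y + + n ℤ.* offset)
                     (sym (sum-permute {n} {n} window (induced p per))) (∑-*ʳ q (+ n)) ⟩
          ∑[ k < n ] window k + (∑[ k < n ] q k) ℤ.* + n + + n ℤ.* offset
            ≡⟨ lemma (∑[ k < n ] window k) (∑[ k < n ] q k) (+ n) ⟩
          ∑[ k < n ] window k  ≡⟨ ∑-window n ⟩
          + (suc n C 2)  ∎
      }
      where
      open ≡-Reasoning
      lemma : ∀ w s n → w + s ℤ.* n + n ℤ.* (- s) ≡ w
      lemma = solve-∀

  -- Suffix minima of 231-avoiding permutations

  Avoids : (ℤ → ℤ) → Set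
  Avoids f = ¬ (∃[ i ] ∃[ j ] ∃[ k ] i < j × j < k × f k < f i × f i < f j)

  -- A specification instead of a function: minima obtained in different ways are identified by
  -- `suffixMinima-unique`.
  record SuffixMinima (f S : ℤ → ℤ) : Set where
    field
      lower    : ∀ {i j} → i ≤ j → S i ≤ f j
      attained : ∀ i → ∃[ j ] i ≤ j × f j ≡ S i

  open SuffixMinima

  suffixMinima-unique : ∀ {f S T} → SuffixMinima f S → SuffixMinima f T → ∀ i → S i ≡ T i
  suffixMinima-unique {f} {S} {T} isS isT i = ≤-antisym (half isS isT) (half isT isS)
    where
    half : ∀ {S T} → SuffixMinima f S → SuffixMinima f T → S i ≤ T i
    half {S} isS isT with j , i≤j , fj≡ ← attained isT i = subst (S i ≤_) fj≡ (lower isS i≤j)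

  suffixMinima-cong : ∀ {f g S} → (∀ i → f i ≡ g i) → SuffixMinima f S → SuffixMinima g S
  suffixMinima-cong {f} {g} {S} f≡g isS = record
    { lower    = λ {i} {j} i≤j → subst (S i ≤_) (f≡g j) (lower isS i≤j)
    ; attained = λ i → let j , i≤j , fj≡ = attained isS i in j , i≤j , trans (sym (f≡g j)) fj≡
    }

  suffixMinima-≗ : ∀ {f S T} → (∀ i → S i ≡ T i) → SuffixMinima f S → SuffixMinima f T
  suffixMinima-≗ {f} {S} {T} S≡T isS = record
    { lower    = λ {i} {j} i≤j → subst (_≤ f j) (S≡T i) (lower isS i≤j)
    ; attained = λ i → let j , i≤j , fj≡ = attained isS i in j , i≤j , trans fj≡ (S≡T i)
    }

  suffixMinima-translate : ∀ {f S} c → SuffixMinima f S → SuffixMinima (λ i → f i + c) (λ i → S i + c)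
  suffixMinima-translate c isS = record
    { lower    = λ i≤j → +-monoˡ-≤ c (lower isS i≤j)
    ; attained = λ i → let j , i≤j , fj≡ = attained isS i in j , i≤j , cong (_+ c) fj≡
    }

  suffixMinima-mono : ∀ {f S} → SuffixMinima f S → ∀ i → S i ≤ S (1+ i)
  suffixMinima-mono {f} {S} isS i with j , 1+i≤j , fj≡ ← attained isS (1+ i) =
    subst (S i ≤_) fj≡ (lower isS (≤-trans (<⇒≤ (<1+ i)) 1+i≤j))

  -- The delayed function `S (i - n) + n` meets the same specification, so uniqueness applies.
  suffixMinima-periodic : ∀ {f S} → Periodic n f → SuffixMinima f S → Periodic n S
  suffixMinima-periodic {f} {S} per isS i =
    trans (suffixMinima-unique isS delayed (i + + n)) (cong (λ j → S j + + n) (add-sub i (+ n)))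
    where
    add-sub : ∀ i n → i + n - n ≡ i
    add-sub = solve-∀
    sub-add : ∀ i n → i - n + n ≡ i
    sub-add = solve-∀
    transpose : ∀ i j n → j - (i - n) ≡ j + n - i
    transpose = solve-∀
    f-shift : ∀ j → f (j - + n) + + n ≡ f j
    f-shift j = trans (sym (per (j - + n))) (cong f (sub-add j (+ n)))
    delayed : SuffixMinima f (λ i → S (i - + n) + + n)
    delayed = record
      { lower    = λ {i} {j} i≤j → subst (S (i - + n) + + n ≤_) (f-shift j)
                     (+-monoˡ-≤ (+ n) (lower isS (+-monoˡ-≤ (- + n) i≤j)))
      ; attained = λ i → let j , i-n≤j , fj≡ = attained isS (i - + n) in
          j + + n , ≤-diff i-n≤j (transpose i j (+ n)) , trans (per j) (cong (_+ + n) fj≡)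
      }

  -- Under a stack reading of a 231-avoiding f, the position i is still available when the
  -- value a is popped, and the most recent available position is the one used.
  stack : ∀ (f : ℤ ↔ ℤ) {S} → Avoids (to f) → SuffixMinima (to f) S →
          ∀ {a i} → S i ≤ a → a ≤ to f i → i ≤ from f a
  stack f {S} avoids isS {a} {i} Si≤a a≤fi = ≮⇒≥ absurd
    where
    q = from f a
    fq≡ : to f q ≡ a
    fq≡ = strictlyInverseˡ f a
    -- Otherwise the value `S i`, found at some `k` beyond `i`, completes a 231 at `q`, `i`, `k`.
    absurd : ¬ q < i
    absurd q<i with k , i≤k , fk≡ ← attained isS i = avoids (q , i , k , q<i , i<k , fk<fq , fq<fi)
      where
      fq<fi : to f q < to f i
      fq<fi = ≤∧≢⇒< (subst (_≤ to f i) (sym fq≡) a≤fi) λ eq → <⇒≢ q<i (to-injective f eq)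
      fk<fq : to f k < to f q
      fk<fq = ≤∧≢⇒< (subst₂ _≤_ (sym fk≡) (sym fq≡) Si≤a)
        λ eq → <⇒≢ (<-≤-trans q<i i≤k) (sym (to-injective f eq))
      i<k : i < k
      i<k = ≤∧≢⇒< i≤k λ i≡k → <-asym fk<fq (subst (λ k → to f q < to f k) i≡k fq<fi)

  -- If g x < f x, the f-position y of the value g x lies to the right of x and again g y < f y;
  -- the values f x > f y > … cannot fall below the common suffix minimum.
  suffixMinima-≮ : ∀ (f g : ℤ ↔ ℤ) {S} → Avoids (to f) → Avoids (to g) →
                   SuffixMinima (to f) S → SuffixMinima (to g) S → ∀ x → ¬ to g x < to f x
  suffixMinima-≮ f g {S} avoidsf avoidsg isf isg x₀ gx₀<fx₀ =
    let d , fx₀≡ = ≤⇒offset (lower isf {x₀} ≤-refl)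
    in go d x₀ ≤-refl (≤-reflexive fx₀≡) gx₀<fx₀
    where
    -- The number `d` bounds how far `f x` lies above the suffix minimum at `x₀`, and it drops with
    -- each move to the right.
    go : ∀ d x → x₀ ≤ x → to f x ≤ S x₀ + + d → ¬ to g x < to f x
    go zero x x₀≤x fx≤ gx<fx =
      <⇒≱ gx<fx (≤-trans fx≤ (subst (_≤ to g x) (sym (+-identityʳ (S x₀))) (lower isg x₀≤x)))
    go (suc d) x x₀≤x fx≤ gx<fx = descend′ (<-cmp (to g y) (to f y))
      where
      y : ℤ
      y = from f (to g x)
      fy≡ : to f y ≡ to g x
      fy≡ = strictlyInverseˡ f (to g x)
      x≤y : x ≤ y
      x≤y = stack f avoidsf isf (lower isg ≤-refl) (<⇒≤ gx<fx)
      x≢y : x ≢ y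
      x≢y x≡y = <⇒≢ gx<fx (sym (trans (cong (to f) x≡y) fy≡))
      fy<fx : to f y < to f x
      fy<fx = subst (_< to f x) (sym fy≡) gx<fx
      descend′ : _ → ⊥
      descend′ (tri< gy<fy _ _) = go d y (≤-trans x₀≤x x≤y)
        (<1+⇒≤ (<-≤-trans fy<fx (subst (to f x ≤_) (+1+ (S x₀) d) fx≤))) gy<fy
      descend′ (tri≈ _ gy≡fy _) = x≢y (to-injective g (sym (trans gy≡fy fy≡)))
      -- With `g y` above `f y = g x`, the stack property of `g` puts `y` at or to the left of `x`.
      descend′ (tri> _ _ fy<gy) = x≢y (≤-antisym x≤y
        (subst (y ≤_) (trans (cong (from g) fy≡) (strictlyInverseʳ g x))
          (stack g avoidsg isg (lower isf ≤-refl) (<⇒≤ fy<gy))))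

  suffixMinima-determine : ∀ (f g : ℤ ↔ ℤ) {S} → Avoids (to f) → Avoids (to g) →
                           SuffixMinima (to f) S → SuffixMinima (to g) S → ∀ x → to f x ≡ to g x
  suffixMinima-determine f g avoidsf avoidsg isf isg x = ≤-antisym
    (≮⇒≥ (suffixMinima-≮ f g avoidsf avoidsg isf isg x))
    (≮⇒≥ (suffixMinima-≮ g f avoidsg avoidsf isg isf x))

  -- P prescribes suffix minima.  The position i is pushed at height P i - i and popped at the
  -- first later position where that height is reached again.
  module Profile (P : ℤ → ℤ) (mono : ∀ i → P i ≤ P (1+ i)) (per : Periodic n P) where

    H : ℤ → ℤ
    H = displacement P

    FirstReturn : ℤ → ℤ → Set
    FirstReturn i e = i < e × H i ≤ H e × (∀ {j} → i < j → j < e → H j < H i)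

    firstReturn-unique : ∀ {i e e′} → FirstReturn i e → FirstReturn i e′ → e ≡ e′
    firstReturn-unique {i} {e} {e′} (i<e , Hi≤He , before) (i<e′ , Hi≤He′ , before′) with <-cmp e e′
    ... | tri< e<e′ _ _ = contradiction (before′ i<e e<e′) (≤⇒≯ Hi≤He)
    ... | tri≈ _ e≡e′ _ = e≡e′
    ... | tri> _ _ e′<e = contradiction (before i<e′ e′<e) (≤⇒≯ Hi≤He′)

    abstract
      firstReturn : ∀ i → ∃[ e ] FirstReturn i e
      -- The search ends by `l = m`, because position `i + n` has the same height as `i`.
      firstReturn i = found (least (λ l → H i ≤? H (i + + suc l)) m
        (≤-reflexive (sym (displacement-invariant {n} {P} per i))))
        where
        found : (∃[ l ] H i ≤ H (i + + suc l) × (∀ k → k ℕ.< l → ¬ H i ≤ H (i + + suc k))) → ∃[ e ] FirstReturn i e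
        found (l , Hi≤ , before) = i + + suc l ,
          subst (i <_) (sym (+1+ i l)) (≤⇒<1+ (i≤i+j i (+ l))) , Hi≤ , below
          where
          below : ∀ {j} → i < j → j < i + + suc l → H j < H i
          below i<j j<e with k , refl ← <⇒offset i<j =
            subst (λ j → H j < H i) (+1+ i k) (≰⇒> (before k (drop‿+<+
              (<-diff j<e (lemma i (+ k) (+ l))))))
            where
            lemma : ∀ i k l → i + (+ 1 + l) - (+ 1 + (i + k)) ≡ l - k
            lemma = solve-∀

    e : ℤ → ℤ
    e i = proj₁ (firstReturn i)

    i<e : ∀ i → i < e i
    i<e i = proj₁ (proj₂ (firstReturn i))

    H≤He : ∀ i → H i ≤ H (e i)
    H≤He i = proj₁ (proj₂ (proj₂ (firstReturn i)))

    before-e : ∀ i {j} → i < j → j < e i → H j < H i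
    before-e i = proj₂ (proj₂ (proj₂ (firstReturn i)))

    -- Up to a constant, the stack size before the push of `i` is `- H i`, and after `v` pops with
    -- `e` next to be pushed it is `e - v`. Entry `i` leaves when the size returns to `- H i`, that
    -- is, at pop `v = H i + e i`.
    f : ℤ → ℤ
    f i = H i + e i

    P<f : ∀ i → P i < f i
    P<f i = <-diff (i<e i) (lemma (P i) i (e i))
      where
      lemma : ∀ p i e → e - i ≡ p - i + e - p
      lemma = solve-∀

    -- Intervals from push to pop are nested: were `e i < e j`, the height at `e i` would be below
    -- `H j < H i`, yet it reaches `H i`.
    f-inside : ∀ {i j} → i < j → j < e i → f j < f i
    f-inside {i} {j} i<j j<e = +-mono-<-≤ (before-e i i<j j<e) (≮⇒≥ λ ei<ej →
      <⇒≱ (<-trans (before-e j j<e ei<ej) (before-e i i<j j<e)) (H≤He i))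

    -- The pop of `i` is numbered at most `P (e i)`, that of `j` more than `P j`, and `P` is
    -- monotone.
    f-outside : ∀ {i j} → e i ≤ j → f i < f j
    f-outside {i} {j} e≤j = begin-strict
      H i + e i      ≤⟨ +-monoˡ-≤ (e i) (H≤He i) ⟩
      H (e i) + e i  ≡⟨ lemma (P (e i)) (e i) ⟩
      P (e i)        ≤⟨ monotone {P} mono e≤j ⟩
      P j            <⟨ P<f j ⟩
      f j            ∎
      where
      open ≤-Reasoning
      lemma : ∀ p e → p - e + e ≡ p
      lemma = solve-∀

    f-distinct : ∀ {i j} → i < j → f i ≢ f j
    f-distinct {i} {j} i<j fi≡fj with j <? e i
    ... | yes j<e = <⇒≢ (f-inside i<j j<e) (sym fi≡fj)
    ... | no  j≮e = <⇒≢ (f-outside (≮⇒≥ j≮e)) fi≡fj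

    f-injective : ∀ {i j} → f i ≡ f j → i ≡ j
    f-injective {i} {j} fi≡fj with <-cmp i j
    ... | tri< i<j _ _ = contradiction fi≡fj (f-distinct i<j)
    ... | tri≈ _ i≡j _ = i≡j
    ... | tri> _ _ j<i = contradiction (sym fi≡fj) (f-distinct j<i)

    f-avoids : Avoids f
    f-avoids (i , j , k , i<j , j<k , fk<fi , fi<fj) with k <? e i
    ... | yes k<e = <-asym fi<fj (f-inside i<j (<-trans j<k k<e))
    ... | no  k≮e = <-asym fk<fi (f-outside (≮⇒≥ k≮e))

    H-invariant : ∀ i → H (i + + n) ≡ H i
    H-invariant = displacement-invariant {n} {P} per

    f-periodic : Periodic n f
    f-periodic i = trans (cong₂ _+_ (H-invariant i) e-shift) (sym (+-assoc (H i) (e i) (+ n)))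
      where
      lemma : ∀ j n → j - n + n ≡ j
      lemma = solve-∀
      H-back : ∀ j → H (j - + n) ≡ H j
      H-back j = trans (sym (H-invariant (j - + n))) (cong H (lemma j (+ n)))
      e-shift : e (i + + n) ≡ e i + + n
      e-shift = firstReturn-unique (proj₂ (firstReturn (i + + n)))
        ( +-monoˡ-< (+ n) (i<e i)
        , subst₂ _≤_ (sym (H-invariant i)) (sym (H-invariant (e i))) (H≤He i)
        , λ {j} i+n<j j<e+n → subst₂ _<_ (H-back j) (sym (H-invariant i))
            (before-e i (+-cancelʳ-< (+ n) (subst (i + + n <_) (sym (lemma j (+ n))) i+n<j))
                        (+-cancelʳ-< (+ n) (subst (_< e i + + n) (sym (lemma j (+ n))) j<e+n)))
        )

    -- The next pop after number `P i` is `P i + 1`. It belongs to the last `j` with `P j = P i`,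
    -- where `P` rises at once and `e j = j + 1`; such a `j` occurs within `n` steps, as
    -- `P (i + n) = P i + n`.
    f-suffixMinima : SuffixMinima f (λ i → P i + + 1)
    f-suffixMinima = record
      { lower    = λ {i} {j} i≤j → subst (_≤ f j) (+-comm (+ 1) (P i))
                     (<⇒1+≤ (≤-<-trans (monotone {P} mono i≤j) (P<f j)))
      ; attained = λ i → climb i (least (λ l → P i <? P (i + + suc l)) m
                     (subst (P i <_) (sym (per i)) (P<P+n i)))
      }
      where
      P<P+n : ∀ i → P i < P i + + n
      P<P+n i = subst (P i <_) (sym (+1+ (P i) m)) (≤⇒<1+ (i≤i+j (P i) (+ m)))

      f-rise : ∀ j → P j < P (1+ j) → f j ≡ P j + + 1
      f-rise j rise = trans (cong (λ e → H j + e) e≡1+j) (lemma₁ (P j) j)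
        where
        lemma₁ : ∀ p j → p - j + (+ 1 + j) ≡ p + + 1
        lemma₁ = solve-∀
        lemma₂ : ∀ p q j → q - (+ 1 + p) ≡ q - (+ 1 + j) - (p - j)
        lemma₂ = solve-∀
        e≡1+j : e j ≡ 1+ j
        e≡1+j = firstReturn-unique (proj₂ (firstReturn j))
          ( <1+ j , ≤-diff (<⇒1+≤ rise) (lemma₂ (P j) (P (1+ j)) j)
          , λ j<i i<1+j → contradiction (<1+⇒≤ i<1+j) (<⇒≱ j<i))

      climb : ∀ i → (∃[ l ] P i < P (i + + suc l) × (∀ k → k ℕ.< l → ¬ P i < P (i + + suc k))) →
              ∃[ j ] i ≤ j × f j ≡ P i + + 1
      climb i (l , rise , flat) = i + + l , i≤i+j i (+ l) , trans (f-rise (i + + l)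
        (subst₂ _<_ (sym (level l flat)) (cong P (+1+ i l)) rise)) (cong (_+ + 1) (level l flat))
        where
        level : ∀ l → (∀ k → k ℕ.< l → ¬ P i < P (i + + suc k)) → P (i + + l) ≡ P i
        level zero    _    = cong P (+-identityʳ i)
        level (suc k) flat = ≤-antisym (≮⇒≥ (flat k ℕ.≤-refl)) (monotone {P} mono (i≤i+j i (+ suc k)))

    bijectionOf : ℤ ↔ ℤ
    bijectionOf = periodic-bijection f f-periodic f-injective

    permutation : AffinePermutation n
    permutation = normalise bijectionOf f-periodic

    shiftOf : ℤ
    shiftOf = + 1 + offset bijectionOf f-periodic

    permutation-avoids : Avoids231 permutation
    permutation-avoids (i , j , k , i<j , j<k , k<i , i<j′) = f-avoids
      (i , j , k , i<j , j<k , +-cancelʳ-< c k<i , +-cancelʳ-< c i<j′)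
      where c = offset bijectionOf f-periodic

    permutation-suffixMinima : SuffixMinima (permutation ⟨_⟩) (λ i → P i + shiftOf)
    permutation-suffixMinima = suffixMinima-≗ (λ i → +-assoc (P i) (+ 1) c)
      (suffixMinima-translate c f-suffixMinima)
      where c = offset bijectionOf f-periodic

  -- Compositions of n into n parts

  minUpTo : (ℤ → ℤ) → ℕ → ℤ → ℤ
  minUpTo f zero    i = f i
  minUpTo f (suc k) i = f i ⊓ minUpTo f k (1+ i)

  minUpTo-lower : ∀ f k i r → r ℕ.≤ k → minUpTo f k i ≤ f (i + + r)
  minUpTo-lower f zero    i zero    _ = ≤-reflexive (cong f (sym (+-identityʳ i)))
  minUpTo-lower f (suc k) i zero    _ = subst (λ j → minUpTo f (suc k) i ≤ f j) (sym (+-identityʳ i)) (i⊓j≤i _ _)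
  minUpTo-lower f (suc k) i (suc r) (ℕ.s≤s r≤k) = ≤-trans (i⊓j≤j (f i) _)
    (subst (λ j → minUpTo f k (1+ i) ≤ f j) (sym (1++ i r)) (minUpTo-lower f k (1+ i) r r≤k))

  minUpTo-attained : ∀ f k i → ∃[ j ] i ≤ j × f j ≡ minUpTo f k i
  minUpTo-attained f zero    i = i , ≤-refl , refl
  minUpTo-attained f (suc k) i with ⊓-sel (f i) (minUpTo f k (1+ i))
  ... | inj₁ eq = i , ≤-refl , sym eq
  ... | inj₂ eq with j , 1+i≤j , fj≡ ← minUpTo-attained f k (1+ i) =
    j , ≤-trans (<⇒≤ (<1+ i)) 1+i≤j , trans fj≡ (sym eq)

  -- Moving by `n` positions raises the value by `n`, so the `n` entries from `i` on contain the
  -- minimum of the whole suffix.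
  minima : AffinePermutation n → ℤ → ℤ
  minima w = minUpTo (w ⟨_⟩) m

  minima-suffixMinima : ∀ w → SuffixMinima (w ⟨_⟩) (minima w)
  minima-suffixMinima w = record { lower = below ; attained = minUpTo-attained (w ⟨_⟩) m }
    where
    below : ∀ {i j} → i ≤ j → minima w i ≤ w ⟨ j ⟩
    below {i} i≤j with d , refl ← ≤⇒offset i≤j = begin
      minima w i                               ≤⟨ minUpTo-lower (w ⟨_⟩) m i r (ℕ.<⇒≤pred (ℕ.m%n<n d n)) ⟩
      w ⟨ i + + r ⟩                            ≤⟨ i≤i+j (w ⟨ i + + r ⟩) (+ (q ℕ.* n)) ⟩
      w ⟨ i + + r ⟩ + + (q ℕ.* n)              ≡⟨ cong (λ x → w ⟨ i + + r ⟩ + x) (pos-* q n) ⟩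
      w ⟨ i + + r ⟩ + + q ℤ.* + n              ≡⟨ sym (shift-periodic′ w (i + + r) (+ q)) ⟩
      w ⟨ i + + r + + q ℤ.* + n ⟩              ≡⟨ cong (w ⟨_⟩) (+-assoc i (+ r) _) ⟩
      w ⟨ i + (+ r + + q ℤ.* + n) ⟩            ≡⟨ cong (λ x → w ⟨ i + (+ r + x) ⟩) (sym (pos-* q n)) ⟩
      w ⟨ i + + (r ℕ.+ q ℕ.* n) ⟩              ≡⟨ cong (λ d → w ⟨ i + + d ⟩) (sym (ℕ.m≡m%n+[m/n]*n d n)) ⟩
      w ⟨ i + + d ⟩                            ∎
      where
      open ≤-Reasoning
      r = d ℕ.% n
      q = d ℕ./ n

  minima-cong : ∀ v w → v ≈ w → ∀ i → minima v i ≡ minima w i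
  minima-cong v w v≈w = suffixMinima-unique (minima-suffixMinima v)
    (suffixMinima-cong (λ i → sym (v≈w i)) (minima-suffixMinima w))

  -- The two-sided discrete antiderivative of `g` that vanishes at zero.
  accumulate : (ℤ → ℤ) → ℤ → ℤ
  accumulate g (+ zero)       = + 0
  accumulate g (+ suc k)      = accumulate g (+ k) + g (+ k)
  accumulate g -[1+ zero ]    = - g -[1+ 0 ]
  accumulate g -[1+ suc k ]   = accumulate g -[1+ k ] - g -[1+ suc k ]

  accumulate-step : ∀ g i → accumulate g (1+ i) ≡ accumulate g i + g i
  accumulate-step g (+ k)        = refl
  accumulate-step g -[1+ zero ]  = sym (+-inverseˡ (g -[1+ 0 ]))
  accumulate-step g -[1+ suc k ] = lemma (accumulate g -[1+ k ]) (g -[1+ suc k ])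
    where
    lemma : ∀ x y → x ≡ x - y + y
    lemma = solve-∀

  telescope : ∀ {f g : ℤ → ℤ} → (∀ i → f (1+ i) ≡ f i + g i) →
              ∀ k i → f (i + + k) ≡ f i + ∑[ j < k ] g (i + + toℕ j)
  telescope {f}     step zero    i = trans (cong f (+-identityʳ i)) (sym (+-identityʳ (f i)))
  telescope {f} {g} step (suc k) i = begin
    f (i + + suc k)                                         ≡⟨ cong f (1++ i k) ⟩
    f (1+ i + + k)                                          ≡⟨ telescope {f} {g} step k (1+ i) ⟩
    f (1+ i) + ∑[ j < k ] g (1+ i + + toℕ j)
      ≡⟨ cong₂ _+_ (step i) (sum-cong-≗ {k} λ j → cong g (sym (1++ i (toℕ j)))) ⟩
    f i + g i + ∑[ j < k ] g (i + + suc (toℕ j))            ≡⟨ +-assoc (f i) (g i) _ ⟩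
    f i + (g i + ∑[ j < k ] g (i + + suc (toℕ j)))
      ≡⟨ cong (λ x → f i + (g x + ∑[ j < k ] g (i + + suc (toℕ j)))) (sym (+-identityʳ i)) ⟩
    f i + (g (i + + 0) + ∑[ j < k ] g (i + + suc (toℕ j)))  ∎
    where open ≡-Reasoning

  ∑-lookup : ∀ {k} (p : Vec ℕ k) → ∑[ i < k ] (+ lookup p i) ≡ + Vec.sum p
  ∑-lookup []      = refl
  ∑-lookup (x ∷ p) = cong (λ y → + x + y) (∑-lookup p)

  res-shift : ∀ i → res (i + + n) ≡ res i
  res-shift i = sym (window-unique (res i) (res (i + + n)) (r - q + -[1+ 0 ])
    (trans (lemma₁ (window (res i)) q (+ n)) (trans (cong (λ x → x + + n - + n - q ℤ.* + n) (sym i≡))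
      (trans (cong (λ x → x - + n - q ℤ.* + n) i+n≡) (lemma₂ (window (res (i + + n))) r q (+ n))))))
    where
    q = proj₁ (proj₂ (residue i))
    r = proj₁ (proj₂ (residue (i + + n)))
    i≡ = proj₂ (proj₂ (residue i))
    i+n≡ = proj₂ (proj₂ (residue (i + + n)))
    lemma₁ : ∀ w q n → w ≡ w + q ℤ.* n + n - n - q ℤ.* n
    lemma₁ = solve-∀
    lemma₂ : ∀ w r q n → w + r ℤ.* n - n - q ℤ.* n ≡ w + (r - q + - + 1) ℤ.* n
    lemma₂ = solve-∀

  res-window : ∀ (k : Fin n) → res (window k) ≡ k
  res-window k =
    let i , q , eq = residue (window k)
    in sym (window-unique k i q eq)

  Composition : Set
  Composition = ∃[ p ] Vec.sum {n} p ≡ n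

  composition-≡ : ∀ {p q : Composition} → proj₁ p ≡ proj₁ q → p ≡ q
  composition-≡ {p , sum≡} {_ , sum≡′} refl = cong (p ,_) (ℕ.≡-irrelevant sum≡ sum≡′)

  increment : (ℤ → ℤ) → ℤ → ℤ
  increment S i = S (1+ i) - S i

  increment-periodic : ∀ {S} → Periodic n S → ∀ (k : Fin n) q →
                       increment S (window k + q ℤ.* + n) ≡ increment S (window k)
  increment-periodic {S} per k q = trans
    (cong₂ _-_ (trans (cong S (sym (+-assoc (+ 1) (window k) (q ℤ.* + n))))
                      (shift-periodic {n} {S} per (1+ window k) q))
               (shift-periodic {n} {S} per (window k) q))
    (lemma (S (1+ window k)) (S (window k)) (q ℤ.* + n))
    where
    lemma : ∀ a b c → a + c - (b + c) ≡ a - b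
    lemma = solve-∀

  increments-determine : ∀ {S T : ℤ → ℤ} → (∀ i → increment S i ≡ increment T i) →
                         ∀ i → S i ≡ T i + (S (+ 0) - T (+ 0))
  increments-determine {S} {T} eq i =
    trans (lemma₁ (S i) (T i)) (cong (λ x → T i + x) (constant {f = D} D-const i))
    where
    D : ℤ → ℤ
    D i = S i - T i
    lemma₁ : ∀ s t → s ≡ t + (s - t)
    lemma₁ = solve-∀
    lemma₂ : ∀ s s′ t′ → s′ - t′ ≡ s + (s′ - s) - t′
    lemma₂ = solve-∀
    lemma₃ : ∀ s t t′ → s + (t′ - t) - t′ ≡ s - t
    lemma₃ = solve-∀
    D-const : ∀ i → D (1+ i) ≡ D i
    D-const i = trans (lemma₂ (S i) (S (1+ i)) (T (1+ i)))
      (trans (cong (λ x → S i + x - T (1+ i)) (eq i)) (lemma₃ (S i) (T i) (T (1+ i))))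

  module Encode (w : AffinePermutation n) where

    S : ℤ → ℤ
    S = minima w

    S-periodic : Periodic n S
    S-periodic = suffixMinima-periodic {w ⟨_⟩} (periodic w) (minima-suffixMinima w)

    parts : Vec ℕ n
    -- The absolute value only changes the type: suffix minima never decrease.
    parts = tabulate λ k → ∣ increment S (window k) ∣

    lookup-parts : ∀ k → + lookup parts k ≡ increment S (window k)
    lookup-parts k = trans (cong +_ (lookup∘tabulate (λ k → ∣ increment S (window k) ∣) k))
      (0≤i⇒+∣i∣≡i (i≤j⇒0≤j-i (suffixMinima-mono (minima-suffixMinima w) (window k))))

    parts-sum : Vec.sum parts ≡ n
    parts-sum = +-injective (begin
      + Vec.sum parts                              ≡⟨ sym (∑-lookup parts) ⟩
      ∑[ k < n ] (+ lookup parts k)                ≡⟨ sum-cong-≗ {n} lookup-parts ⟩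
      ∑[ k < n ] increment S (window k)            ≡⟨ lemma₁ (S (+ 1)) _ ⟩
      S (+ 1) + ∑[ k < n ] increment S (window k) - S (+ 1)
        ≡⟨ cong (_- S (+ 1)) (sym (telescope {S} {increment S} (λ i → lemma₂ (S i) (S (1+ i))) n (+ 1))) ⟩
      S (+ 1 + + n) - S (+ 1)                      ≡⟨ cong (_- S (+ 1)) (S-periodic (+ 1)) ⟩
      S (+ 1) + + n - S (+ 1)                      ≡⟨ sym (lemma₁ (S (+ 1)) (+ n)) ⟩
      + n                                          ∎)
      where
      open ≡-Reasoning
      lemma₁ : ∀ s x → x ≡ s + x - s
      lemma₁ = solve-∀
      lemma₂ : ∀ a b → b ≡ a + (b - a)
      lemma₂ = solve-∀

    encode : Composition
    encode = parts , parts-sum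

  open Encode using (parts; encode)

  parts-cong : ∀ v w → v ≈ w → parts v ≡ parts w
  parts-cong v w v≈w = tabulate-cong λ k →
    cong₂ (λ a b → ∣ a - b ∣) (minima-cong v w v≈w (1+ window k)) (minima-cong v w v≈w (window k))

  module Decode (code : Composition) where

    part : ℤ → ℤ
    part i = + lookup (proj₁ code) (res i)

    P : ℤ → ℤ
    P = accumulate part

    P-mono : ∀ i → P i ≤ P (1+ i)
    P-mono i = subst (P i ≤_) (sym (accumulate-step part i)) (i≤i+j (P i) (part i))

    P-periodic : Periodic n P
    P-periodic i = trans (lemma₁ (P (i + + n)) (P i)) (cong (λ x → P i + x)
      -- The rise over a period is constant; it is evaluated at 1, where the window starts.
      (trans (constant {f = D} D-const i) (trans (sym (constant {f = D} D-const (+ 1))) D1≡n)))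
      where
      D : ℤ → ℤ
      D i = P (i + + n) - P i
      lemma₁ : ∀ a b → a ≡ b + (a - b)
      lemma₁ = solve-∀
      lemma₂ : ∀ a b x → a + x - (b + x) ≡ a - b
      lemma₂ = solve-∀
      lemma₃ : ∀ a s → a + s - a ≡ s
      lemma₃ = solve-∀
      D-const : ∀ i → D (1+ i) ≡ D i
      D-const i = trans
        (cong₂ _-_ (trans (cong P (+-assoc (+ 1) i (+ n)))
                          (trans (accumulate-step part (i + + n))
                                 (cong (λ k → P (i + + n) + + lookup (proj₁ code) k) (res-shift i))))
                   (accumulate-step part i))
        (lemma₂ (P (i + + n)) (P i) (part i))
      D1≡n : D (+ 1) ≡ + n
      D1≡n = begin
        P (+ 1 + + n) - P (+ 1)
          ≡⟨ cong (_- P (+ 1)) (telescope {P} {part} (accumulate-step part) n (+ 1)) ⟩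
        P (+ 1) + ∑[ k < n ] part (window k) - P (+ 1)       ≡⟨ lemma₃ (P (+ 1)) _ ⟩
        ∑[ k < n ] part (window k)
          ≡⟨ sum-cong-≗ {n} (λ k → cong (λ k → + lookup (proj₁ code) k) (res-window k)) ⟩
        ∑[ k < n ] (+ lookup (proj₁ code) k)                 ≡⟨ ∑-lookup (proj₁ code) ⟩
        + Vec.sum (proj₁ code)                               ≡⟨ cong +_ (proj₂ code) ⟩
        + n                                                  ∎
        where open ≡-Reasoning

    open Profile P P-mono P-periodic public using (permutation; permutation-avoids; permutation-suffixMinima; shiftOf)

    increment-P : ∀ i → increment P i ≡ part i
    increment-P i = trans (cong (_- P i) (accumulate-step part i)) (lemma (P i) (part i))
      where
      lemma : ∀ a x → a + x - a ≡ x
      lemma = solve-∀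

    minima-permutation : ∀ i → minima permutation i ≡ P i + shiftOf
    minima-permutation = suffixMinima-unique (minima-suffixMinima permutation) permutation-suffixMinima

    parts-permutation : parts permutation ≡ proj₁ code
    parts-permutation = trans (tabulate-cong same) (tabulate∘lookup (proj₁ code))
      where
      lemma : ∀ a b c → a + c - (b + c) ≡ a - b
      lemma = solve-∀
      same : ∀ k → ∣ increment (minima permutation) (window k) ∣ ≡ lookup (proj₁ code) k
      same k = cong ∣_∣ (begin
        increment (minima permutation) (window k)
          ≡⟨ cong₂ _-_ (minima-permutation (1+ window k)) (minima-permutation (window k)) ⟩
        P (1+ window k) + shiftOf - (P (window k) + shiftOf)
          ≡⟨ lemma (P (1+ window k)) (P (window k)) shiftOf ⟩
        increment P (window k)  ≡⟨ increment-P (window k) ⟩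
        part (window k)         ≡⟨ cong (λ k → + lookup (proj₁ code) k) (res-window k) ⟩
        + lookup (proj₁ code) k ∎)
        where open ≡-Reasoning

    encode-≈-decode : ∀ w → w ≈ permutation → encode w ≡ code
    encode-≈-decode w w≈ = composition-≡ (trans (parts-cong w permutation w≈) parts-permutation)

  open Decode using (encode-≈-decode) renaming (permutation to decode; permutation-avoids to decode-avoids)

  -- The code keeps only increments, so the decoded element is first matched, by its suffix minima,
  -- with `w` translated by some `c`; normalisation then forces `c = 0`.
  decode-encode : ∀ w → Avoids231 w → decode (encode w) ≈ w
  decode-encode w avoids i = trans (v≡w+c i) (trans (cong (λ x → w ⟨ i ⟩ + x) c≡0) (+-identityʳ _))
    where
    open Encode w using (S; S-periodic; lookup-parts)
    open Decode (encode w) using (P; part; increment-P; permutation-suffixMinima; shiftOf; P-periodic)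
    v : AffinePermutation n
    v = decode (encode w)
    same-increments : ∀ i → increment P i ≡ increment S i
    same-increments i = trans (increment-P i) (trans (lookup-parts (res i))
      (trans (sym (increment-periodic {S} S-periodic (res i) (proj₁ (proj₂ (residue i)))))
             (cong (increment S) (sym (proj₂ (proj₂ (residue i)))))))
    c₀ c : ℤ
    c₀ = P (+ 0) - S (+ 0)
    c = c₀ + shiftOf
    w+c : ℤ ↔ ℤ
    w+c = translation c ↔-∘ bijection w
    w+c-avoids : Avoids (to w+c)
    w+c-avoids (i , j , k , i<j , j<k , k<i , i<j′) =
      avoids (i , j , k , i<j , j<k , +-cancelʳ-< c k<i , +-cancelʳ-< c i<j′)
    v-suffixMinima : SuffixMinima (v ⟨_⟩) (λ i → S i + c)
    v-suffixMinima = suffixMinima-≗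
      (λ i → trans (cong (_+ shiftOf) (increments-determine {P} {S} same-increments i))
                   (+-assoc (S i) c₀ shiftOf))
      permutation-suffixMinima
    v≡w+c : ∀ i → v ⟨ i ⟩ ≡ w ⟨ i ⟩ + c
    v≡w+c = suffixMinima-determine (bijection v) w+c (decode-avoids (encode w)) w+c-avoids
      v-suffixMinima (suffixMinima-translate c (minima-suffixMinima w))
    c≡0 : c ≡ + 0
    c≡0 = translation-trivial v w v≡w+c

  -- The bijection between compositions and sortable elements.

  compositions↔sortables : Inverse (setoid Composition) (oneStackSortables n)
  compositions↔sortables = record
    { to        = decode-sortable
    ; from      = λ (w , _) → encode w
    ; to-cong   = λ { refl _ → refl }
    ; from-cong = λ {(v , _)} {(w , _)} v≈w → composition-≡ (parts-cong v w v≈w)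
    ; inverse   = (λ { {w , sortable} refl → decode-encode-sortable w sortable })
                , (λ {code} {(w , _)} → encode-≈-decode code w)
    }
    where
    decode-sortable : Composition → ∃[ w ] OneStackSortable w
    decode-sortable code =
      decode code , Equivalence.from (sortable⇔avoids231 (decode code)) (decode-avoids code)
    decode-encode-sortable : ∀ w → OneStackSortable w → decode (encode w) ≈ w
    decode-encode-sortable w sortable = decode-encode w (Equivalence.to (sortable⇔avoids231 w) sortable)

-- Enumeration of compositions

-- A first part equal to zero is deleted, any other is lowered by one; the recursion follows this
-- split, which also matches Pascal's rule.
compositions : ℕ → ℕ → ℕ
compositions zero    zero    = 1
compositions zero    (suc s) = 0
compositions (suc k) zero    = compositions k zero
compositions (suc k) (suc s) = compositions k (suc s) ℕ.+ compositions (suc k) s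

compositions-0 : ∀ k → compositions k 0 ≡ 1
compositions-0 zero    = refl
compositions-0 (suc k) = compositions-0 k

compositions-C : ∀ k s → compositions (suc k) s ≡ (s ℕ.+ k) C s
compositions-C k       zero    = compositions-0 k
compositions-C zero    (suc s) = trans (compositions-C 0 s)
  (trans (cong (_C s) (ℕ.+-identityʳ s)) (trans (nCn≡1 s)
    (sym (trans (cong (λ x → suc x C suc s) (ℕ.+-identityʳ s)) (nCn≡1 (suc s))))))
compositions-C (suc k) (suc s) = begin
  compositions (suc k) (suc s) ℕ.+ compositions (suc (suc k)) s
    ≡⟨ cong₂ ℕ._+_ (compositions-C k (suc s)) (compositions-C (suc k) s) ⟩
  suc (s ℕ.+ k) C suc s ℕ.+ (s ℕ.+ suc k) C s
    ≡⟨ cong (λ x → x C suc s ℕ.+ (s ℕ.+ suc k) C s) (sym (ℕ.+-suc s k)) ⟩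
  (s ℕ.+ suc k) C suc s ℕ.+ (s ℕ.+ suc k) C s  ≡⟨ ℕ.+-comm ((s ℕ.+ suc k) C suc s) _ ⟩
  (s ℕ.+ suc k) C s ℕ.+ (s ℕ.+ suc k) C suc s  ≡⟨ nCk+nC[k+1]≡[n+1]C[k+1] (s ℕ.+ suc k) s ⟩
  suc (s ℕ.+ suc k) C suc s                    ∎
  where open ≡-Reasoning

WithSum : ℕ → ℕ → Set
WithSum k s = ∃[ p ] Vec.sum {k} p ≡ s

withSum-0 : ∀ k → WithSum k 0 ↔ WithSum (suc k) 0
withSum-0 k = mk↔ₛ′ cons tail (λ { (zero ∷ p , eq) → refl }) (λ _ → refl)
  where
  cons : WithSum k 0 → WithSum (suc k) 0
  cons (p , eq) = 0 ∷ p , eq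
  tail : WithSum (suc k) 0 → WithSum k 0
  tail (zero ∷ p , eq) = p , eq

withSum-suc : ∀ k s → (WithSum k (suc s) ⊎ WithSum (suc k) s) ↔ WithSum (suc k) (suc s)
withSum-suc k s = mk↔ₛ′ increase decrease
  (λ { (zero ∷ p , eq) → refl ; (suc x ∷ p , refl) → refl })
  (λ { (inj₁ (p , eq)) → refl ; (inj₂ (x ∷ p , refl)) → refl })
  where
  increase : WithSum k (suc s) ⊎ WithSum (suc k) s → WithSum (suc k) (suc s)
  increase (inj₁ (p , eq))     = 0 ∷ p , eq
  increase (inj₂ (x ∷ p , eq)) = suc x ∷ p , cong suc eq
  decrease : WithSum (suc k) (suc s) → WithSum k (suc s) ⊎ WithSum (suc k) s
  decrease (zero ∷ p , eq)  = inj₁ (p , eq)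
  decrease (suc x ∷ p , eq) = inj₂ (x ∷ p , ℕ.suc-injective eq)

count : ∀ k s → Fin (compositions k s) ↔ WithSum k s
count zero    zero    = mk↔ₛ′ (λ _ → [] , refl) (λ _ → Fin.zero)
  (λ { ([] , refl) → refl }) (λ { Fin.zero → refl ; (Fin.suc ()) })
count zero    (suc s) = mk↔ₛ′ (λ ()) (λ { ([] , ()) }) (λ { ([] , ()) }) (λ ())
count (suc k) zero    = withSum-0 k ↔-∘ count k zero
count (suc k) (suc s) = withSum-suc k s ↔-∘ ((count k (suc s) ⊎-↔ count (suc k) s) ↔-∘ +↔⊎)

compositions-2n∸1 : ∀ m → (2 * suc m ∸ 1) C suc m ≡ compositions (suc m) (suc m)
compositions-2n∸1 m = sym (trans (compositions-C m (suc m))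
  (cong (_C suc m) (trans (ℕ.+-comm (suc m) m) (cong (m ℕ.+_) (sym (ℕ.+-identityʳ (suc m)))))))

proposition8p2 : (n : ℕ) .{{_ : NonZero n}} →
    ((w : AffinePermutation n) → OneStackSortable w ⇔ Avoids231 w) ×
    Inverse (setoid (Fin ((2 * n ∸ 1) C n))) (oneStackSortables n)
proposition8p2 (suc m) = sortable⇔avoids231 ,
  subst (λ N → Inverse (setoid (Fin N)) (oneStackSortables (suc m))) (sym (compositions-2n∸1 m))
    (inverse (count (suc m) (suc m)) compositions↔sortables)
  where open AffineRank m
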